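{- Let $K$ be a field of characteristic $0$ and let $G(x,t),F(x,t)\in K[[x,t]]$. Suppose $G(x,0)=ax+(\text{terms of higher degree in }x)$ with $a\in K$, $a\neq 0$. Then $$\mathop{\mathrm{CT}}_x\ \frac{x}{G(x,t)}\,F(x,t)=\left.\frac{F(x,t)}{\frac{\partial}{\partial x}G(x,t)}\right|_{x=X},$$ where $X=X(t)$ is the unique element of $tK[[t]]$ such that $G(X,t)=0$, and where $1/G(x,t)$ is computed in the field $K((x))((t))$.
   Context: $K((x))((t))$ is the field of Laurent series in $t$ with coefficients in the field $K((x))$ of Laurent series in $x$. For $f=\sum_{n\ge n_0}a_n(x)t^n\in K((x))((t))$ with $a_n(x)\in K((x))$, $\mathrm{CT}_xf=\sum_{n\ge n_0}([x^0]a_n(x))\,t^n\in K((t))$. -}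

module Defs where

open import Algebra.Apartness.Bundles using (HeytingCommutativeRing; HeytingField)
open import Algebra.Bundles using (CommutativeRing)
open import Algebra.Bundles.Raw using (RawRing)
import Algebra.Definitions as Definitions
import Algebra.Definitions.RawSemiring as RawSemiringDefinitions
open import Data.Fin.Base using (toℕ)
open import Data.Integer.Base as ℤ using (ℤ; +_; -[1+_]; 0ℤ; _⊖_)
open import Data.Nat.Base as ℕ using (ℕ; zero; suc; _∸_; _⊔_)
open import Level as Level using (Level)
open import Relation.Nullary.Negation using (¬_)

fieldRawRing : ∀ {c ℓ₁ ℓ₂ : Level} → HeytingField c ℓ₁ ℓ₂ → RawRing c ℓ₁
fieldRawRing K = CommutativeRing.rawRing
  (HeytingCommutativeRing.commutativeRing (HeytingField.heytingCommutativeRing K))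

CharacteristicZero : ∀ {c ℓ₁ ℓ₂ : Level} → HeytingField c ℓ₁ ℓ₂ → Set ℓ₁
CharacteristicZero K = ∀ (n : ℕ) → ¬ (suc n × 1# ≈ 0#)
  where
  open RawRing (fieldRawRing K)
  open RawSemiringDefinitions rawSemiring using (_×_)

Invertible : ∀ {c ℓ : Level} (R : RawRing c ℓ) → RawRing.Carrier R → Set _
Invertible R = Definitions.Invertible _≈_ 1# _*_
  where open RawRing R

-- A carrier element f of powerSeries stands for Σ f n tⁿ.

module _ {c ℓ : Level} (R : RawRing c ℓ) where
  open RawRing R
  open RawSemiringDefinitions rawSemiring using (sum)

  cauchyProduct : (ℕ → Carrier) → (ℕ → Carrier) → ℕ → Carrier
  cauchyProduct f g n = sum {suc n} (λ i → f (toℕ i) * g (n ∸ toℕ i))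

  constant : Carrier → ℕ → Carrier
  constant a zero    = a
  constant a (suc _) = 0#

  powerSeries : RawRing c ℓ
  powerSeries = record
    { Carrier = ℕ → Carrier
    ; _≈_     = λ f g → ∀ n → f n ≈ g n
    ; _+_     = λ f g n → f n + g n
    ; _*_     = cauchyProduct
    ; -_      = λ f n → - f n
    ; 0#      = λ _ → 0#
    ; 1#      = constant 1#
    }

-- (pole , series) stands for Σₙ series n · t^(n - pole).  Leading zeros are
-- allowed, so a lower bound n₀ = - pole ≤ 0 on the exponents is no restriction,
-- and one Laurent series has many representations: equality is equality of
-- the coefficients at all integer exponents.

record Laurent {c : Level} (A : Set c) : Set c where
  constructor laurent
  field
    pole   : ℕ
    series : ℕ → A

open Laurent public

fromSeries : ∀ {c : Level} {A : Set c} → (ℕ → A) → Laurent A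
fromSeries = laurent 0

module _ {c ℓ : Level} (R : RawRing c ℓ) where
  open RawRing R

  coeff : Laurent Carrier → ℤ → Carrier
  coeff f k with k ℤ.+ + pole f
  ... | + n      = series f n
  ... | -[1+ _ ] = 0#

  laurentSeries : RawRing c ℓ
  laurentSeries = record
    { Carrier = Laurent Carrier
    ; _≈_     = λ f g → ∀ k → coeff f k ≈ coeff g k
    ; _+_     = λ f g → let p = pole f ⊔ pole g in
                  laurent p (λ n → coeff f (n ⊖ p) + coeff g (n ⊖ p))
    ; _*_     = λ f g → laurent (pole f ℕ.+ pole g)
                                (cauchyProduct R (series f) (series g))
    ; -_      = λ f → laurent (pole f) (λ n → - series f n)
    ; 0#      = fromSeries (λ _ → 0#)
    ; 1#      = fromSeries (constant R 1#)
    }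

module Series {c ℓ₁ ℓ₂ : Level} (K : HeytingField c ℓ₁ ℓ₂) where

  K-rawRing : RawRing c ℓ₁
  K-rawRing = fieldRawRing K

  open HeytingField K public using (Carrier; _≈_; _#_; 0#)
  open RawRing K-rawRing using (1#; rawSemiring)
  open RawSemiringDefinitions rawSemiring using (_×_; sum)

  K⟦t⟧ K⟨⟨t⟩⟩ K⟨⟨x⟩⟩ K⟨⟨x⟩⟩⟨⟨t⟩⟩ : RawRing c ℓ₁
  K⟦t⟧         = powerSeries K-rawRing
  K⟨⟨t⟩⟩       = laurentSeries K-rawRing
  K⟨⟨x⟩⟩       = laurentSeries K-rawRing
  K⟨⟨x⟩⟩⟨⟨t⟩⟩  = laurentSeries K⟨⟨x⟩⟩

  module K⟦t⟧        = RawRing K⟦t⟧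
  module K⟨⟨t⟩⟩      = RawRing K⟨⟨t⟩⟩
  module K⟨⟨x⟩⟩      = RawRing K⟨⟨x⟩⟩
  module K⟨⟨x⟩⟩⟨⟨t⟩⟩ = RawRing K⟨⟨x⟩⟩⟨⟨t⟩⟩

  -- G i j is the coefficient of xⁱ tʲ, so G i is the coefficient of xⁱ in K⟦t⟧.
  K⟦x,t⟧ : Set c
  K⟦x,t⟧ = ℕ → ℕ → Carrier

  ∂x : K⟦x,t⟧ → K⟦x,t⟧
  ∂x G i j = suc i × G (suc i) j

  embed : K⟦x,t⟧ → K⟨⟨x⟩⟩⟨⟨t⟩⟩.Carrier
  embed G = fromSeries (λ j → fromSeries (λ i → G i j))

  x : K⟨⟨x⟩⟩⟨⟨t⟩⟩.Carrier
  x = fromSeries (constant K⟨⟨x⟩⟩ (fromSeries λ { 1 → 1# ; _ → 0# }))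

  CTₓ : K⟨⟨x⟩⟩⟨⟨t⟩⟩.Carrier → K⟨⟨t⟩⟩.Carrier
  CTₓ f = laurent (pole f) (λ n → coeff K-rawRing (series f n) 0ℤ)

  record tK⟦t⟧ : Set (c Level.⊔ ℓ₁) where
    field
      value      : K⟦t⟧.Carrier
      constant≈0 : value 0 ≈ 0#

  open tK⟦t⟧ public

  _≈ᵗ_ : tK⟦t⟧ → tK⟦t⟧ → Set ℓ₁
  X ≈ᵗ Y = value X K⟦t⟧.≈ value Y

  -- G(X,t) = Σᵢ G i · Xⁱ.  As X has no constant term, Xⁱ is divisible by tⁱ,
  -- so only the terms with i ≤ n contribute to the coefficient of tⁿ.
  _at_ : K⟦x,t⟧ → tK⟦t⟧ → K⟦t⟧.Carrier
  (G at X) n = sum {suc n} (λ i → (G (toℕ i) K⟦t⟧.* value X ^ toℕ i) n)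
    where open RawSemiringDefinitions K⟦t⟧.rawSemiring using (_^_)

{-# OPTIONS --safe #-}

-- Let S = K[[t]].  Evaluation at X ∈ tK[[t]] is a ring homomorphism ev : S[[x]] → S
-- determined by ev G = G₀ + X · ev ((G - G₀) / x).  Since ev G = 0, one can divide:
-- G = (x - X) H, where H(0,0) = a, so H is a unit, and ev H = ev (∂G/∂x).
-- With Q = F / H, the series E = x F / G satisfies (x - X) E = x Q, hence the
-- coefficients E_k ∈ K((t)) of xᵏ satisfy E_k = Q_k + X E_{k+1} for k ≥ 0.  As X is
-- divisible by t, this recurrence has only one solution, so
-- CT E = E_0 = ev Q = ev F / ev (∂G/∂x).

module Submission where

open import Defs
open import Algebra.Apartness.Bundles using (HeytingCommutativeRing; HeytingField)
open import Algebra.Bundles using (CommutativeRing)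
open import Algebra.Bundles.Raw using (RawRing)
import Algebra.Definitions.RawSemiring as RawSemiringDefinitions
import Algebra.Properties.CommutativeMonoid.Mult as CommutativeMonoidMult
import Algebra.Properties.CommutativeSemigroup as CommutativeSemigroupProperties
import Algebra.Properties.Ring as RingProperties
import Algebra.Properties.Semiring.Mult as SemiringMult
import Algebra.Properties.Semiring.Sum as SemiringSum
open import Data.Fin.Base as Fin using (Fin; toℕ)
open import Data.Integer.Base as ℤ using (ℤ; +_; -[1+_]; _⊖_)
import Data.Integer.Properties as ℤ
open import Data.Nat.Base as ℕ using (ℕ; zero; suc; z≤n; s≤s; _∸_; _⊔_)
import Data.Nat.Properties as ℕ
open import Data.Product using (_×_; ∃; ∃!; _,_; proj₁; proj₂)
open import Function.Base using (_∘_)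
open import Level using (Level)
open import Relation.Binary.PropositionalEquality as ≡ using (_≡_)
import Relation.Binary.Reasoning.Setoid as SetoidReasoning

-- The coefficients of E at successive powers of t can have poles in x of growing order, so E cannot
-- be evaluated at x = X; only Q can. The recurrence avoids this, since it links E_k and E_{k+1} for
-- k ≥ 0 and never reaches a negative power of x. It also has no starting value: it runs upward for
-- ever and is pinned down because m steps produce the factor X^m, which vanishes modulo t^m. With
-- series themselves as indices and the tail as successor, the same uniqueness yields that ev is a
-- homomorphism: both sides of each law solve one recurrence. The inverse of G is arbitrary, so its
-- representative may have any pole in t. Multiplying E by the power t^p that clears this pole moves
-- the comparison into K[[t]]. The root X comes from a Hensel argument. As G_1 is a unit of K[[t]],
-- G(X,t) = 0 reads X = -(G_0 + X² w(X)) / G_1 with G = G_0 + x G_1 + x² w. Writing X = tZ turns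
-- this into a contraction in Z.

module PowerSeriesProperties {c ℓ : Level} (R : CommutativeRing c ℓ) where
  open CommutativeRing R
  open SetoidReasoning setoid
  private
    module + = CommutativeSemigroupProperties +-commutativeSemigroup

  open RawRing (powerSeries rawRing) public using ()
    renaming (_≈_ to _≋_; _+_ to _⊕_; _*_ to _⊛_; -_ to ⊝_; 0# to 0ₛ; 1# to 1ₛ)

  -- Formal power series over a commutative ring: the ring structure.

  scale : Carrier → (ℕ → Carrier) → ℕ → Carrier
  scale a f n = a * f n

  shift : (ℕ → Carrier) → ℕ → Carrier
  shift f zero    = 0#
  shift f (suc n) = f n

  shift^ : ℕ → (ℕ → Carrier) → ℕ → Carrier
  shift^ zero    f = f
  shift^ (suc p) f = shift (shift^ p f)

  infix 4 _≈[<_]_ _≈[≤_]_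

  _≈[<_]_ _≈[≤_]_ : (ℕ → Carrier) → ℕ → (ℕ → Carrier) → Set ℓ
  f ≈[< n ] g = ∀ m → m ℕ.< n → f m ≈ g m
  f ≈[≤ n ] g = ∀ m → m ℕ.≤ n → f m ≈ g m

  -- By definitional unfolding, `(f ⊛ g) (suc n)` is `f 0 * g (suc n) + ((f ∘ suc) ⊛ g) n`, and
  -- `(f ⊛ g) 0` carries a trailing `+ 0#`. The inductions on products rest on this peeling of the
  -- left factor.
  ⊛-cong-≤ : ∀ {f f′ g g′} n → f ≈[≤ n ] f′ → g ≈[≤ n ] g′ → (f ⊛ g) n ≈ (f′ ⊛ g′) n
  ⊛-cong-≤ zero    p q = +-congʳ (*-cong (p 0 z≤n) (q 0 z≤n))
  ⊛-cong-≤ (suc n) p q = +-cong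
    (*-cong (p 0 z≤n) (q (suc n) ℕ.≤-refl))
    (⊛-cong-≤ n (λ m → p (suc m) ∘ s≤s) (λ m → q m ∘ ℕ.m≤n⇒m≤1+n))

  ⊛-cong : ∀ {f f′ g g′} → f ≋ f′ → g ≋ g′ → f ⊛ g ≋ f′ ⊛ g′
  ⊛-cong p q n = ⊛-cong-≤ n (λ m _ → p m) (λ m _ → q m)

  ⊛-congˡ : ∀ f {g g′} → g ≋ g′ → f ⊛ g ≋ f ⊛ g′
  ⊛-congˡ f = ⊛-cong {f} (λ _ → refl)

  -- The product unfolds by itself only along its left factor; this mirror image is what
  -- commutativity needs.
  ⊛-sucʳ : ∀ f g n → (f ⊛ g) (suc n) ≈ f (suc n) * g 0 + (f ⊛ (g ∘ suc)) n
  ⊛-sucʳ f g zero    = +.x∙yz≈y∙xz _ _ _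
  ⊛-sucʳ f g (suc n) = begin
    f 0 * g (suc (suc n)) + ((f ∘ suc) ⊛ g) (suc n)
      ≈⟨ +-congˡ (⊛-sucʳ (f ∘ suc) g n) ⟩
    f 0 * g (suc (suc n)) + (f (suc (suc n)) * g 0 + ((f ∘ suc) ⊛ (g ∘ suc)) n)
      ≈⟨ +.x∙yz≈y∙xz _ _ _ ⟩
    f (suc (suc n)) * g 0 + (f ⊛ (g ∘ suc)) (suc n) ∎

  ⊛-comm : ∀ f g → f ⊛ g ≋ g ⊛ f
  ⊛-comm f g zero    = +-congʳ (*-comm _ _)
  ⊛-comm f g (suc n) = begin
    f 0 * g (suc n) + ((f ∘ suc) ⊛ g) n  ≈⟨ +-cong (*-comm _ _) (⊛-comm (f ∘ suc) g n) ⟩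
    g (suc n) * f 0 + (g ⊛ (f ∘ suc)) n  ≈⟨ ⊛-sucʳ g f n ⟨
    (g ⊛ f) (suc n)                      ∎

  ⊛-distribʳ : ∀ h f g → (f ⊕ g) ⊛ h ≋ (f ⊛ h) ⊕ (g ⊛ h)
  ⊛-distribʳ h f g zero    = begin
    (f 0 + g 0) * h 0 + 0#             ≈⟨ +-cong (distribʳ _ _ _) (sym (+-identityˡ _)) ⟩
    f 0 * h 0 + g 0 * h 0 + (0# + 0#)  ≈⟨ +.interchange _ _ _ _ ⟩
    f 0 * h 0 + 0# + (g 0 * h 0 + 0#)  ∎
  ⊛-distribʳ h f g (suc n) = begin
    (f 0 + g 0) * h (suc n) + (((f ⊕ g) ∘ suc) ⊛ h) n
      ≈⟨ +-cong (distribʳ _ _ _) (⊛-distribʳ h (f ∘ suc) (g ∘ suc) n) ⟩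
    f 0 * h (suc n) + g 0 * h (suc n) + (((f ∘ suc) ⊛ h) n + ((g ∘ suc) ⊛ h) n)
      ≈⟨ +.interchange _ _ _ _ ⟩
    (f ⊛ h) (suc n) + (g ⊛ h) (suc n) ∎

  ⊛-distribˡ : ∀ h f g → h ⊛ (f ⊕ g) ≋ (h ⊛ f) ⊕ (h ⊛ g)
  ⊛-distribˡ h f g n = begin
    (h ⊛ (f ⊕ g)) n        ≈⟨ ⊛-comm h (f ⊕ g) n ⟩
    ((f ⊕ g) ⊛ h) n        ≈⟨ ⊛-distribʳ h f g n ⟩
    (f ⊛ h) n + (g ⊛ h) n  ≈⟨ +-cong (⊛-comm f h n) (⊛-comm g h n) ⟩
    (h ⊛ f) n + (h ⊛ g) n  ∎

  scale-⊛ : ∀ a f g → scale a f ⊛ g ≋ scale a (f ⊛ g)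
  scale-⊛ a f g zero    = begin
    a * f 0 * g 0 + 0#         ≈⟨ +-cong (*-assoc _ _ _) (sym (zeroʳ a)) ⟩
    a * (f 0 * g 0) + a * 0#   ≈⟨ distribˡ _ _ _ ⟨
    a * (f 0 * g 0 + 0#)       ∎
  scale-⊛ a f g (suc n) = begin
    a * f 0 * g (suc n) + (scale a (f ∘ suc) ⊛ g) n    ≈⟨ +-cong (*-assoc _ _ _) (scale-⊛ a (f ∘ suc) g n) ⟩
    a * (f 0 * g (suc n)) + a * ((f ∘ suc) ⊛ g) n      ≈⟨ distribˡ _ _ _ ⟨
    a * (f ⊛ g) (suc n)                                ∎

  ⊛-assoc : ∀ f g h → (f ⊛ g) ⊛ h ≋ f ⊛ (g ⊛ h)
  ⊛-assoc f g h zero    = +-congʳ (begin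
    (f 0 * g 0 + 0#) * h 0  ≈⟨ *-congʳ (+-identityʳ _) ⟩
    f 0 * g 0 * h 0         ≈⟨ *-assoc _ _ _ ⟩
    f 0 * (g 0 * h 0)       ≈⟨ *-congˡ (+-identityʳ _) ⟨
    f 0 * (g 0 * h 0 + 0#)  ∎)
  ⊛-assoc f g h (suc n) = begin
    -- The tail of `f ⊛ g` is definitionally `scale (f 0) (g ∘ suc) ⊕ ((f ∘ suc) ⊛ g)`, so
    -- distributivity applies to it.
    (f 0 * g 0 + 0#) * h (suc n) + ((scale (f 0) (g ∘ suc) ⊕ ((f ∘ suc) ⊛ g)) ⊛ h) n
      ≈⟨ +-cong (trans (*-congʳ (+-identityʳ _)) (*-assoc _ _ _))
                (⊛-distribʳ h (scale (f 0) (g ∘ suc)) ((f ∘ suc) ⊛ g) n) ⟩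
    f 0 * (g 0 * h (suc n)) + ((scale (f 0) (g ∘ suc) ⊛ h) n + (((f ∘ suc) ⊛ g) ⊛ h) n)
      ≈⟨ +-congˡ (+-cong (scale-⊛ (f 0) (g ∘ suc) h n) (⊛-assoc (f ∘ suc) g h n)) ⟩
    f 0 * (g 0 * h (suc n)) + (f 0 * ((g ∘ suc) ⊛ h) n + ((f ∘ suc) ⊛ (g ⊛ h)) n)
      ≈⟨ +-assoc _ _ _ ⟨
    f 0 * (g 0 * h (suc n)) + f 0 * ((g ∘ suc) ⊛ h) n + ((f ∘ suc) ⊛ (g ⊛ h)) n
      ≈⟨ +-congʳ (distribˡ _ _ _) ⟨
    f 0 * (g ⊛ h) (suc n) + ((f ∘ suc) ⊛ (g ⊛ h)) n ∎

  ⊛-zeroˡ : ∀ f → 0ₛ ⊛ f ≋ 0ₛ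
  ⊛-zeroˡ f zero    = trans (+-identityʳ _) (zeroˡ _)
  ⊛-zeroˡ f (suc n) = trans (+-cong (zeroˡ _) (⊛-zeroˡ f n)) (+-identityʳ _)

  constant-⊛ : ∀ a f → constant rawRing a ⊛ f ≋ scale a f
  constant-⊛ a f zero    = +-identityʳ _
  constant-⊛ a f (suc n) = trans (+-congˡ (⊛-zeroˡ f n)) (+-identityʳ _)

  ⊛-identityˡ : ∀ f → 1ₛ ⊛ f ≋ f
  ⊛-identityˡ f n = trans (constant-⊛ 1# f n) (*-identityˡ _)

  powerSeriesRing : CommutativeRing c ℓ
  powerSeriesRing = record
    { RawRing (powerSeries rawRing)
    ; isCommutativeRing = record
      { isRing = record
        { +-isAbelianGroup = record
          { isGroup = record
            { isMonoid = record
              { isSemigroup = record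
                { isMagma = record
                  { isEquivalence = record
                    { refl  = λ _ → refl
                    ; sym   = λ p n → sym (p n)
                    ; trans = λ p q n → trans (p n) (q n)
                    }
                  ; ∙-cong = λ p q n → +-cong (p n) (q n)
                  }
                ; assoc = λ f g h n → +-assoc (f n) (g n) (h n)
                }
              ; identity = (λ f n → +-identityˡ (f n)) , (λ f n → +-identityʳ (f n))
              }
            ; inverse = (λ f n → -‿inverseˡ (f n)) , (λ f n → -‿inverseʳ (f n))
            ; ⁻¹-cong = λ p n → -‿cong (p n)
            }
          ; comm = λ f g n → +-comm (f n) (g n)
          }
        ; *-cong     = ⊛-cong
        ; *-assoc    = ⊛-assoc
        ; *-identity = ⊛-identityˡ , (λ f n → trans (⊛-comm f 1ₛ n) (⊛-identityˡ f n))
        ; distrib    = ⊛-distribˡ , ⊛-distribʳ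
        }
      ; *-comm = ⊛-comm
      }
    }

  -- Multiplication by powers of t, congruence modulo powers of t, fixed points.

  shift-cong : ∀ {f g} → f ≋ g → shift f ≋ shift g
  shift-cong p zero    = refl
  shift-cong p (suc n) = p n

  shift^-cong : ∀ p {f g} → f ≋ g → shift^ p f ≋ shift^ p g
  shift^-cong zero    q = q
  shift^-cong (suc p) q = shift-cong (shift^-cong p q)

  shift^-shift^ : ∀ p q f → shift^ p (shift^ q f) ≡ shift^ (p ℕ.+ q) f
  shift^-shift^ zero    q f = ≡.refl
  shift^-shift^ (suc p) q f = ≡.cong shift (shift^-shift^ p q f)

  shift-⊕ : ∀ f g → shift (f ⊕ g) ≋ shift f ⊕ shift g
  shift-⊕ f g zero    = sym (+-identityʳ _)
  shift-⊕ f g (suc n) = refl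

  shift^-⊕ : ∀ p f g → shift^ p (f ⊕ g) ≋ shift^ p f ⊕ shift^ p g
  shift^-⊕ zero    f g n = refl
  shift^-⊕ (suc p) f g n = trans (shift-cong (shift^-⊕ p f g) n) (shift-⊕ _ _ n)

  shift-⊛ : ∀ f g → shift f ⊛ g ≋ shift (f ⊛ g)
  shift-⊛ f g zero    = trans (+-identityʳ _) (zeroˡ _)
  shift-⊛ f g (suc n) = trans (+-congʳ (zeroˡ _)) (+-identityˡ _)

  shift^-⊛ : ∀ p f g → shift^ p f ⊛ g ≋ shift^ p (f ⊛ g)
  shift^-⊛ zero    f g n = refl
  shift^-⊛ (suc p) f g n = trans (shift-⊛ (shift^ p f) g n) (shift-cong (shift^-⊛ p f g) n)

  ⊛-shift^ : ∀ p f g → f ⊛ shift^ p g ≋ shift^ p (f ⊛ g)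
  ⊛-shift^ p f g n = begin
    (f ⊛ shift^ p g) n    ≈⟨ ⊛-comm f (shift^ p g) n ⟩
    (shift^ p g ⊛ f) n    ≈⟨ shift^-⊛ p g f n ⟩
    shift^ p (g ⊛ f) n    ≈⟨ shift^-cong p (⊛-comm g f) n ⟩
    shift^ p (f ⊛ g) n    ∎

  shift-tail : ∀ {f} → f 0 ≈ 0# → f ≋ shift (f ∘ suc)
  shift-tail p zero    = p
  shift-tail p (suc n) = refl

  ⊛-0 : ∀ f g → f 0 ≈ 0# → (f ⊛ g) 0 ≈ 0#
  ⊛-0 f g p = trans (+-identityʳ _) (trans (*-congʳ p) (zeroˡ _))

  ⊛-suc : ∀ f g n → f 0 ≈ 0# → (f ⊛ g) (suc n) ≈ ((f ∘ suc) ⊛ g) n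
  ⊛-suc f g n p = trans (+-congʳ (trans (*-congʳ p) (zeroˡ _))) (+-identityˡ _)

  ⊛-cong-[<] : ∀ n {f f′ g g′} → f ≈[< n ] f′ → g ≈[< n ] g′ → f ⊛ g ≈[< n ] f′ ⊛ g′
  ⊛-cong-[<] n {f} {f′} p q m m<n = ⊛-cong-≤ {f} {f′} m
    (λ k k≤m → p k (ℕ.≤-<-trans k≤m m<n)) (λ k k≤m → q k (ℕ.≤-<-trans k≤m m<n))

  shift-cong-[<] : ∀ n {f g} → f ≈[< n ] g → shift f ≈[< suc n ] shift g
  shift-cong-[<] n p zero    _         = refl
  shift-cong-[<] n p (suc m) (s≤s m<n) = p m m<n

  -- A factor divisible by t gains one order of precision. This strict bound drives the t-adic
  -- inductions on recurrences.
  ⊛-cong-< : ∀ h {f g} n → h 0 ≈ 0# → f ≈[< n ] g → (h ⊛ f) n ≈ (h ⊛ g) n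
  ⊛-cong-< h {f} {g} zero    h₀ p = trans (⊛-0 h f h₀) (sym (⊛-0 h g h₀))
  ⊛-cong-< h {f} {g} (suc n) h₀ p = begin
    (h ⊛ f) (suc n)      ≈⟨ ⊛-suc h f n h₀ ⟩
    ((h ∘ suc) ⊛ f) n    ≈⟨ ⊛-cong-≤ {h ∘ suc} n (λ _ _ → refl) (λ m → p m ∘ s≤s) ⟩
    ((h ∘ suc) ⊛ g) n    ≈⟨ ⊛-suc h g n h₀ ⟨
    (h ⊛ g) (suc n)      ∎

  -- Two solutions of A i = C i + X A (next i) agree modulo every power of t,
  -- as X has no constant term.
  recurrence-unique : ∀ {i} {I : Set i} (next : I → I) {X} → X 0 ≈ 0# →
    ∀ (A B C : I → ℕ → Carrier) →
    (∀ i → A i ≋ C i ⊕ (X ⊛ A (next i))) → (∀ i → B i ≋ C i ⊕ (X ⊛ B (next i))) →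
    ∀ i → A i ≋ B i
  recurrence-unique next {X} X₀ A B C p q i n = below (suc n) i n ℕ.≤-refl
    where
    below : ∀ n i → A i ≈[< n ] B i
    below (suc n) i m (s≤s m≤n) = begin
      A i m                            ≈⟨ p i m ⟩
      C i m + (X ⊛ A (next i)) m
        ≈⟨ +-congˡ (⊛-cong-< X m X₀ (λ k k<m → below n (next i) k (ℕ.<-≤-trans k<m m≤n))) ⟩
      C i m + (X ⊛ B (next i)) m       ≈⟨ q i m ⟨
      B i m                            ∎

  -- Contraction for the t-adic metric, put coefficientwise so that no limit has to be taken.
  Contraction : ((ℕ → Carrier) → ℕ → Carrier) → Set _
  Contraction Φ = ∀ n {f g} → f ≈[< n ] g → Φ f n ≈ Φ g n

  module _ {Φ : (ℕ → Carrier) → ℕ → Carrier} (contr : Contraction Φ) where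

    private
      iterate : ℕ → ℕ → Carrier
      iterate zero    = 0ₛ
      iterate (suc n) = Φ (iterate n)

      step : ∀ n → iterate n ≈[< n ] iterate (suc n)
      step (suc n) m (s≤s m≤n) = contr m (λ i i<m → step n i (ℕ.<-≤-trans i<m m≤n))

      stable′ : ∀ m d → iterate (suc m) m ≈ iterate (d ℕ.+ suc m) m
      stable′ m zero    = refl
      stable′ m (suc d) = trans (stable′ m d) (step (d ℕ.+ suc m) m (ℕ.m≤n+m (suc m) d))

      stable : ∀ n → (λ m → iterate (suc m) m) ≈[< n ] iterate n
      stable n m m<n = ≡.subst (λ k → iterate (suc m) m ≈ iterate k m)
                               (ℕ.m∸n+n≡m m<n) (stable′ m (n ∸ suc m))

    -- Coefficient n no longer changes from iterate `suc n` onwards, so the diagonal of the iterates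
    -- is their limit.
    fixpoint : ∃ λ f → f ≋ Φ f
    fixpoint = (λ n → iterate (suc n) n) , λ n → contr n (λ m m<n → sym (stable n m m<n))

    fixpoint-unique : ∀ {f g} → f ≋ Φ f → g ≋ Φ g → f ≋ g
    fixpoint-unique {f} {g} p q n = below (suc n) n ℕ.≤-refl
      where
      below : ∀ n → f ≈[< n ] g
      below (suc n) m (s≤s m≤n) = trans (p m) (trans
        (contr m (λ i i<m → below n i (ℕ.<-≤-trans i<m m≤n))) (sym (q m)))

  -- The inverse is the fixed point of g ↦ u (1 - (f - f 0) g).
  inverse : ∀ f u → f 0 * u ≈ 1# → ∃ λ g → f ⊛ g ≋ 1ₛ
  inverse f u f₀u≈1 = g , isInverse
    where
    Φ : (ℕ → Carrier) → ℕ → Carrier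
    Φ g zero    = u
    Φ g (suc n) = u * - ((f ∘ suc) ⊛ g) n

    contr : Contraction Φ
    contr zero    p = refl
    contr (suc n) p = *-congˡ (-‿cong (⊛-cong-≤ {f ∘ suc} n (λ _ _ → refl) (λ m → p m ∘ s≤s)))

    g : ℕ → Carrier
    g = proj₁ (fixpoint contr)

    isInverse : f ⊛ g ≋ 1ₛ
    isInverse zero    = trans (+-identityʳ _) (trans (*-congˡ (proj₂ (fixpoint contr) 0)) f₀u≈1)
    isInverse (suc n) = begin
      f 0 * g (suc n) + ((f ∘ suc) ⊛ g) n                  ≈⟨ +-congʳ (*-congˡ (proj₂ (fixpoint contr) (suc n))) ⟩
      f 0 * (u * - ((f ∘ suc) ⊛ g) n) + ((f ∘ suc) ⊛ g) n  ≈⟨ +-congʳ (*-assoc _ _ _) ⟨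
      f 0 * u * - ((f ∘ suc) ⊛ g) n + ((f ∘ suc) ⊛ g) n    ≈⟨ +-congʳ (*-congʳ f₀u≈1) ⟩
      1# * - ((f ∘ suc) ⊛ g) n + ((f ∘ suc) ⊛ g) n         ≈⟨ +-congʳ (*-identityˡ _) ⟩
      - ((f ∘ suc) ⊛ g) n + ((f ∘ suc) ⊛ g) n              ≈⟨ -‿inverseˡ _ ⟩
      0#                                                   ∎

-- The equation G₀ + X (G₁ + X w) = 0 solved for the X multiplying G₁, a unit with inverse V.
module RootEquation {c ℓ : Level} (R : CommutativeRing c ℓ) where
  open CommutativeRing R
  open SetoidReasoning setoid
  open RingProperties ring using (+-inverseˡ-unique)
  private
    module + = CommutativeSemigroupProperties +-commutativeSemigroup

  module _ {G₀ G₁ V : Carrier} (V-inverse : G₁ * V ≈ 1#) (X w : Carrier) where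

    private
      rearrange : G₀ + X * (G₁ + X * w) ≈ G₁ * X + (G₀ + X * (X * w))
      rearrange = trans (+-congˡ (trans (distribˡ _ _ _) (+-congʳ (*-comm _ _)))) (+.x∙yz≈y∙xz _ _ _)

    root⇒fixpoint : G₀ + X * (G₁ + X * w) ≈ 0# → X ≈ V * - (G₀ + X * (X * w))
    root⇒fixpoint eq = begin
      X                              ≈⟨ *-identityˡ X ⟨
      1# * X                         ≈⟨ *-congʳ (trans (*-comm _ _) V-inverse) ⟨
      V * G₁ * X                     ≈⟨ *-assoc _ _ _ ⟩
      V * (G₁ * X)                   ≈⟨ *-congˡ (+-inverseˡ-unique _ _ (trans (sym rearrange) eq)) ⟩
      V * - (G₀ + X * (X * w))       ∎

    fixpoint⇒root : X ≈ V * - (G₀ + X * (X * w)) → G₀ + X * (G₁ + X * w) ≈ 0#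
    fixpoint⇒root eq = begin
      G₀ + X * (G₁ + X * w)          ≈⟨ rearrange ⟩
      G₁ * X + Y                     ≈⟨ +-congʳ (*-congˡ eq) ⟩
      G₁ * (V * - Y) + Y             ≈⟨ +-congʳ (*-assoc _ _ _) ⟨
      G₁ * V * - Y + Y               ≈⟨ +-congʳ (trans (*-congʳ V-inverse) (*-identityˡ _)) ⟩
      - Y + Y                        ≈⟨ -‿inverseˡ Y ⟩
      0#                             ∎
      where
      Y : Carrier
      Y = G₀ + X * (X * w)

-- Formal Laurent series over a commutative ring.

module LaurentProperties {c ℓ : Level} (R : CommutativeRing c ℓ) where
  open CommutativeRing R
  open SetoidReasoning setoid
  open PowerSeriesProperties R

  open RawRing (laurentSeries rawRing) public using ()
    renaming (_≈_ to _≈ₗ_; _+_ to _+ₗ_; _*_ to _*ₗ_; -_ to -ₗ_; 0# to 0ₗ; 1# to 1ₗ)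

  -- Separates the extension by zero to negative exponents from the translation by the pole; both
  -- are fused in the `with` of `coeff`.
  extend : (ℕ → Carrier) → ℤ → Carrier
  extend f (+ n)    = f n
  extend f -[1+ _ ] = 0#

  extend-cong : ∀ {f g} → f ≋ g → ∀ k → extend f k ≈ extend g k
  extend-cong p (+ n)    = p n
  extend-cong p -[1+ _ ] = refl

  extend-⊕ : ∀ f g k → extend (f ⊕ g) k ≈ extend f k + extend g k
  extend-⊕ f g (+ n)    = refl
  extend-⊕ f g -[1+ _ ] = sym (+-identityʳ _)

  extend-shift : ∀ f k → extend (shift f) (ℤ.suc k) ≡ extend f k
  extend-shift f (+ n)            = ≡.refl
  extend-shift f -[1+ zero ]      = ≡.refl
  extend-shift f -[1+ suc _ ]     = ≡.refl

  extend-shift^ : ∀ p f k → extend (shift^ p f) (k ℤ.+ + p) ≡ extend f k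
  extend-shift^ zero    f k = ≡.cong (extend f) (ℤ.+-identityʳ k)
  extend-shift^ (suc p) f k = ≡.trans
    (≡.cong (extend (shift^ (suc p) f)) (lemma k))
    (≡.trans (extend-shift (shift^ p f) (k ℤ.+ + p)) (extend-shift^ p f k))
    where
    lemma : ∀ k → k ℤ.+ + suc p ≡ ℤ.suc (k ℤ.+ + p)
    lemma k = ≡.trans (≡.sym (ℤ.+-assoc k (+ 1) (+ p)))
             (≡.trans (≡.cong (ℤ._+ + p) (ℤ.+-comm k (+ 1))) (ℤ.+-assoc (+ 1) k (+ p)))

  coeff-extend : ∀ f k → coeff rawRing f k ≡ extend (series f) (k ℤ.+ + pole f)
  coeff-extend f k with k ℤ.+ + pole f
  ... | + n      = ≡.refl
  ... | -[1+ _ ] = ≡.refl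

  -- A pole can be raised to any larger p by moving a power of t into the series, which brings two
  -- Laurent series to a common pole.
  coeff-raise : ∀ f {p} → pole f ℕ.≤ p → ∀ k →
    coeff rawRing f k ≡ extend (shift^ (p ∸ pole f) (series f)) (k ℤ.+ + p)
  coeff-raise f {p} le k = ≡.trans (coeff-extend f k) (≡.trans
    (≡.sym (extend-shift^ (p ∸ pole f) (series f) (k ℤ.+ + pole f)))
    (≡.cong (extend _) (≡.trans (ℤ.+-assoc k (+ pole f) (+ (p ∸ pole f)))
                                (≡.cong (λ q → k ℤ.+ + q) (ℕ.m+[n∸m]≡n le)))))

  private
    n⊖p+p≡n : ∀ n p → (n ⊖ p) ℤ.+ + p ≡ + n
    n⊖p+p≡n n p = ≡.trans (≡.cong (ℤ._+ + p) (≡.sym (ℤ.m-n≡m⊖n n p)))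
      (≡.trans (ℤ.+-assoc (+ n) (ℤ.- + p) (+ p))
      (≡.trans (≡.cong (λ k → + n ℤ.+ k) (ℤ.+-inverseˡ (+ p))) (ℤ.+-identityʳ (+ n))))

  coeff-⊖ : ∀ f {p} → pole f ℕ.≤ p → ∀ n →
    coeff rawRing f (n ⊖ p) ≡ shift^ (p ∸ pole f) (series f) n
  coeff-⊖ f {p} le n = ≡.trans (coeff-raise f le (n ⊖ p)) (≡.cong (extend _) (n⊖p+p≡n n p))

  -- Laurent series are fractions with denominator a power of t, and this is cross multiplication,
  -- obtained by raising both poles to their sum. Together with its converse it moves multiplicative
  -- laws into power series.
  ≈ₗ⇒≋ : ∀ {f g} → f ≈ₗ g → shift^ (pole g) (series f) ≋ shift^ (pole f) (series g)
  ≈ₗ⇒≋ {f} {g} f≈g n = begin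
    shift^ (pole g) (series f) n
      ≡⟨ ≡.cong (λ q → shift^ q (series f) n) (ℕ.m+n∸m≡n (pole f) (pole g)) ⟨
    shift^ (p ∸ pole f) (series f) n             ≡⟨ coeff-⊖ f (ℕ.m≤m+n (pole f) (pole g)) n ⟨
    coeff rawRing f (n ⊖ p)                      ≈⟨ f≈g (n ⊖ p) ⟩
    coeff rawRing g (n ⊖ p)                      ≡⟨ coeff-⊖ g (ℕ.m≤n+m (pole g) (pole f)) n ⟩
    shift^ (p ∸ pole g) (series g) n
      ≡⟨ ≡.cong (λ q → shift^ q (series g) n) (ℕ.m+n∸n≡m (pole f) (pole g)) ⟩
    shift^ (pole f) (series g) n                 ∎
    where
    p : ℕ
    p = pole f ℕ.+ pole g

  ≋⇒≈ₗ : ∀ {f g} → shift^ (pole g) (series f) ≋ shift^ (pole f) (series g) → f ≈ₗ g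
  ≋⇒≈ₗ {f} {g} eq k = begin
    coeff rawRing f k                                     ≡⟨ coeff-raise f (ℕ.m≤m+n (pole f) (pole g)) k ⟩
    extend (shift^ (p ∸ pole f) (series f)) (k ℤ.+ + p)
      ≡⟨ ≡.cong (λ q → extend (shift^ q (series f)) (k ℤ.+ + p)) (ℕ.m+n∸m≡n (pole f) (pole g)) ⟩
    extend (shift^ (pole g) (series f)) (k ℤ.+ + p)       ≈⟨ extend-cong eq (k ℤ.+ + p) ⟩
    extend (shift^ (pole f) (series g)) (k ℤ.+ + p)
      ≡⟨ ≡.cong (λ q → extend (shift^ q (series g)) (k ℤ.+ + p)) (ℕ.m+n∸n≡m (pole f) (pole g)) ⟨
    extend (shift^ (p ∸ pole g) (series g)) (k ℤ.+ + p)   ≡⟨ coeff-raise g (ℕ.m≤n+m (pole g) (pole f)) k ⟨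
    coeff rawRing g k                                     ∎
    where
    p : ℕ
    p = pole f ℕ.+ pole g

  +ₗ-series : ∀ f g → series (f +ₗ g) ≋
    shift^ ((pole f ⊔ pole g) ∸ pole f) (series f) ⊕ shift^ ((pole f ⊔ pole g) ∸ pole g) (series g)
  +ₗ-series f g n = +-cong (reflexive (coeff-⊖ f (ℕ.m≤m⊔n (pole f) (pole g)) n))
                           (reflexive (coeff-⊖ g (ℕ.m≤n⊔m (pole f) (pole g)) n))

  coeff-+ₗ : ∀ f g k → coeff rawRing (f +ₗ g) k ≈ coeff rawRing f k + coeff rawRing g k
  coeff-+ₗ f g k = begin
    coeff rawRing (f +ₗ g) k                       ≡⟨ coeff-extend (f +ₗ g) k ⟩
    extend (series (f +ₗ g)) (k ℤ.+ + p)           ≈⟨ extend-cong (+ₗ-series f g) (k ℤ.+ + p) ⟩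
    extend (F ⊕ G) (k ℤ.+ + p)                     ≈⟨ extend-⊕ F G (k ℤ.+ + p) ⟩
    extend F (k ℤ.+ + p) + extend G (k ℤ.+ + p)    ≡⟨ ≡.cong₂ _+_ (coeff-raise f (ℕ.m≤m⊔n (pole f) (pole g)) k)
                                                                  (coeff-raise g (ℕ.m≤n⊔m (pole f) (pole g)) k) ⟨
    coeff rawRing f k + coeff rawRing g k          ∎
    where
    p : ℕ
    p = pole f ⊔ pole g
    F G : ℕ → Carrier
    F = shift^ (p ∸ pole f) (series f)
    G = shift^ (p ∸ pole g) (series g)

  coeff-0ₗ : ∀ k → coeff rawRing 0ₗ k ≡ 0#
  coeff-0ₗ k with k ℤ.+ + 0
  ... | + n      = ≡.refl
  ... | -[1+ _ ] = ≡.refl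

  coeff--ₗ : ∀ f k → coeff rawRing (-ₗ f) k ≈ - coeff rawRing f k
  coeff--ₗ f k with k ℤ.+ + pole f
  ... | + n      = refl
  ... | -[1+ _ ] = sym -0#≈0#
    where open RingProperties ring using (-0#≈0#)

  *ₗ-comm : ∀ f g → f *ₗ g ≈ₗ g *ₗ f
  *ₗ-comm f g = ≋⇒≈ₗ {f *ₗ g} {g *ₗ f} λ n → begin
    shift^ (pole g ℕ.+ pole f) (series f ⊛ series g) n
      ≡⟨ ≡.cong (λ q → shift^ q (series f ⊛ series g) n) (ℕ.+-comm (pole g) (pole f)) ⟩
    shift^ (pole f ℕ.+ pole g) (series f ⊛ series g) n
      ≈⟨ shift^-cong (pole f ℕ.+ pole g) (⊛-comm (series f) (series g)) n ⟩
    shift^ (pole f ℕ.+ pole g) (series g ⊛ series f) n  ∎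

  *ₗ-congˡ : ∀ h {f g} → f ≈ₗ g → h *ₗ f ≈ₗ h *ₗ g
  *ₗ-congˡ h {f} {g} f≈g = ≋⇒≈ₗ {h *ₗ f} {h *ₗ g} λ n → begin
    shift^ (pole h ℕ.+ pole g) (series h ⊛ series f) n
      ≡⟨ ≡.cong-app (shift^-shift^ (pole h) (pole g) _) n ⟨
    shift^ (pole h) (shift^ (pole g) (series h ⊛ series f)) n
      ≈⟨ shift^-cong (pole h) (⊛-shift^ (pole g) (series h) (series f)) n ⟨
    shift^ (pole h) (series h ⊛ shift^ (pole g) (series f)) n
      ≈⟨ shift^-cong (pole h) (⊛-congˡ (series h) (≈ₗ⇒≋ {f} {g} f≈g)) n ⟩
    shift^ (pole h) (series h ⊛ shift^ (pole f) (series g)) n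
      ≈⟨ shift^-cong (pole h) (⊛-shift^ (pole f) (series h) (series g)) n ⟩
    shift^ (pole h) (shift^ (pole f) (series h ⊛ series g)) n
      ≡⟨ ≡.cong-app (shift^-shift^ (pole h) (pole f) _) n ⟩
    shift^ (pole h ℕ.+ pole f) (series h ⊛ series g) n             ∎

  ≋⇒≈ₗ-pole : ∀ {f g} → pole f ≡ pole g → series f ≋ series g → f ≈ₗ g
  ≋⇒≈ₗ-pole {f} {g} ≡.refl eq = ≋⇒≈ₗ {f} {g} (shift^-cong (pole f) eq)

  *ₗ-assoc : ∀ f g h → (f *ₗ g) *ₗ h ≈ₗ f *ₗ (g *ₗ h)
  *ₗ-assoc f g h = ≋⇒≈ₗ-pole {(f *ₗ g) *ₗ h} {f *ₗ (g *ₗ h)}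
    (ℕ.+-assoc (pole f) (pole g) (pole h)) (⊛-assoc (series f) (series g) (series h))

  *ₗ-identityˡ : ∀ f → 1ₗ *ₗ f ≈ₗ f
  *ₗ-identityˡ f = ≋⇒≈ₗ-pole {1ₗ *ₗ f} {f} ≡.refl (⊛-identityˡ (series f))

  *ₗ-distribˡ : ∀ f g h → f *ₗ (g +ₗ h) ≈ₗ (f *ₗ g) +ₗ (f *ₗ h)
  *ₗ-distribˡ f g h k = begin
    coeff rawRing (f *ₗ (g +ₗ h)) k
      ≡⟨ coeff-extend (f *ₗ (g +ₗ h)) k ⟩
    extend (series f ⊛ series (g +ₗ h)) z
      ≈⟨ extend-cong (⊛-congˡ (series f) (+ₗ-series g h)) z ⟩
    extend (series f ⊛ (shift^ (r ∸ pole g) (series g) ⊕ shift^ (r ∸ pole h) (series h))) z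
      ≈⟨ extend-cong (⊛-distribˡ (series f) _ _) z ⟩
    extend ((series f ⊛ shift^ (r ∸ pole g) (series g)) ⊕ (series f ⊛ shift^ (r ∸ pole h) (series h))) z
      ≈⟨ extend-⊕ _ _ z ⟩
    extend (series f ⊛ shift^ (r ∸ pole g) (series g)) z + extend (series f ⊛ shift^ (r ∸ pole h) (series h)) z
      ≈⟨ +-cong (summand g (ℕ.m≤m⊔n (pole g) (pole h))) (summand h (ℕ.m≤n⊔m (pole g) (pole h))) ⟩
    coeff rawRing (f *ₗ g) k + coeff rawRing (f *ₗ h) k
      ≈⟨ coeff-+ₗ (f *ₗ g) (f *ₗ h) k ⟨
    coeff rawRing ((f *ₗ g) +ₗ (f *ₗ h)) k ∎
    where
    r : ℕ
    r = pole g ⊔ pole h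
    z : ℤ
    z = k ℤ.+ + (pole f ℕ.+ r)
    -- Multiplication by f adds `pole f` to the actual pole and to the common pole r alike, so the
    -- raising shift `r ∸ pole g` is unchanged.
    summand : ∀ g → pole g ℕ.≤ r →
      extend (series f ⊛ shift^ (r ∸ pole g) (series g)) z ≈ coeff rawRing (f *ₗ g) k
    summand g le = begin
      extend (series f ⊛ shift^ (r ∸ pole g) (series g)) z
        ≈⟨ extend-cong (⊛-shift^ (r ∸ pole g) (series f) (series g)) z ⟩
      extend (shift^ (r ∸ pole g) (series f ⊛ series g)) z
        ≡⟨ ≡.cong (λ q → extend (shift^ q (series f ⊛ series g)) z) (ℕ.[m+n]∸[m+o]≡n∸o (pole f) r (pole g)) ⟨
      extend (shift^ ((pole f ℕ.+ r) ∸ (pole f ℕ.+ pole g)) (series f ⊛ series g)) z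
        ≡⟨ coeff-raise (f *ₗ g) (ℕ.+-monoʳ-≤ (pole f) le) k ⟨
      coeff rawRing (f *ₗ g) k ∎

  laurentRing : CommutativeRing c ℓ
  laurentRing = record
    { RawRing (laurentSeries rawRing)
    ; isCommutativeRing = record
      { isRing = record
        { +-isAbelianGroup = record
          { isGroup = record
            { isMonoid = record
              { isSemigroup = record
                { isMagma = record
                  { isEquivalence = record
                    { refl  = λ _ → refl
                    ; sym   = λ p k → sym (p k)
                    ; trans = λ p q k → trans (p k) (q k)
                    }
                  ; ∙-cong = λ {f} {f′} {g} {g′} p q k →
                      trans (coeff-+ₗ f g k) (trans (+-cong (p k) (q k)) (sym (coeff-+ₗ f′ g′ k)))
                  }
                ; assoc = λ f g h k → begin
                    coeff rawRing ((f +ₗ g) +ₗ h) k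
                      ≈⟨ trans (coeff-+ₗ (f +ₗ g) h k) (+-congʳ (coeff-+ₗ f g k)) ⟩
                    coeff rawRing f k + coeff rawRing g k + coeff rawRing h k      ≈⟨ +-assoc _ _ _ ⟩
                    coeff rawRing f k + (coeff rawRing g k + coeff rawRing h k)
                      ≈⟨ trans (coeff-+ₗ f (g +ₗ h) k) (+-congˡ (coeff-+ₗ g h k)) ⟨
                    coeff rawRing (f +ₗ (g +ₗ h)) k                                ∎
                }
              ; identity =
                  (λ f k → trans (coeff-+ₗ 0ₗ f k) (trans (+-congʳ (reflexive (coeff-0ₗ k))) (+-identityˡ _))) ,
                  (λ f k → trans (coeff-+ₗ f 0ₗ k) (trans (+-congˡ (reflexive (coeff-0ₗ k))) (+-identityʳ _)))
              }
            ; inverse =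
                (λ f k → trans (coeff-+ₗ (-ₗ f) f k) (trans (+-congʳ (coeff--ₗ f k))
                           (trans (-‿inverseˡ _) (sym (reflexive (coeff-0ₗ k)))))) ,
                (λ f k → trans (coeff-+ₗ f (-ₗ f) k) (trans (+-congˡ (coeff--ₗ f k))
                           (trans (-‿inverseʳ _) (sym (reflexive (coeff-0ₗ k))))))
            ; ⁻¹-cong = λ {f} {g} p k → trans (coeff--ₗ f k) (trans (-‿cong (p k)) (sym (coeff--ₗ g k)))
            }
          ; comm = λ f g k → trans (coeff-+ₗ f g k) (trans (+-comm _ _) (sym (coeff-+ₗ g f k)))
          }
        ; *-cong = λ {f} {f′} {g} {g′} p q k → begin
            coeff rawRing (f *ₗ g) k     ≈⟨ *ₗ-congˡ f {g} {g′} q k ⟩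
            coeff rawRing (f *ₗ g′) k    ≈⟨ *ₗ-comm f g′ k ⟩
            coeff rawRing (g′ *ₗ f) k    ≈⟨ *ₗ-congˡ g′ {f} {f′} p k ⟩
            coeff rawRing (g′ *ₗ f′) k   ≈⟨ *ₗ-comm g′ f′ k ⟩
            coeff rawRing (f′ *ₗ g′) k   ∎
        ; *-assoc = *ₗ-assoc
        ; *-identity = *ₗ-identityˡ , (λ f k → trans (*ₗ-comm f 1ₗ k) (*ₗ-identityˡ f k))
        ; distrib = *ₗ-distribˡ , (λ f g h k → begin
            coeff rawRing ((g +ₗ h) *ₗ f) k                          ≈⟨ *ₗ-comm (g +ₗ h) f k ⟩
            coeff rawRing (f *ₗ (g +ₗ h)) k                          ≈⟨ *ₗ-distribˡ f g h k ⟩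
            coeff rawRing ((f *ₗ g) +ₗ (f *ₗ h)) k                   ≈⟨ coeff-+ₗ (f *ₗ g) (f *ₗ h) k ⟩
            coeff rawRing (f *ₗ g) k + coeff rawRing (f *ₗ h) k      ≈⟨ +-cong (*ₗ-comm f g k) (*ₗ-comm f h k) ⟩
            coeff rawRing (g *ₗ f) k + coeff rawRing (h *ₗ f) k      ≈⟨ coeff-+ₗ (g *ₗ f) (h *ₗ f) k ⟨
            coeff rawRing ((g *ₗ f) +ₗ (h *ₗ f)) k                   ∎)
        }
      ; *-comm = *ₗ-comm
      }
    }

  coeff-fromSeries : ∀ f n → coeff rawRing (fromSeries f) (+ n) ≡ f n
  coeff-fromSeries f n = ≡.trans (coeff-extend (fromSeries f) (+ n)) (≡.cong f (ℕ.+-identityʳ n))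

  fromSeries-⊕ : ∀ f g → fromSeries f +ₗ fromSeries g ≈ₗ fromSeries (f ⊕ g)
  fromSeries-⊕ f g k = begin
    coeff rawRing (fromSeries f +ₗ fromSeries g) k                 ≈⟨ coeff-+ₗ (fromSeries f) (fromSeries g) k ⟩
    coeff rawRing (fromSeries f) k + coeff rawRing (fromSeries g) k
      ≡⟨ ≡.cong₂ _+_ (coeff-extend (fromSeries f) k) (coeff-extend (fromSeries g) k) ⟩
    extend f (k ℤ.+ + 0) + extend g (k ℤ.+ + 0)                    ≈⟨ extend-⊕ f g (k ℤ.+ + 0) ⟨
    extend (f ⊕ g) (k ℤ.+ + 0)                                     ≡⟨ coeff-extend (fromSeries (f ⊕ g)) k ⟨
    coeff rawRing (fromSeries (f ⊕ g)) k                           ∎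

  private
    module Σ = SemiringSum semiring
    module Σₗ = SemiringSum (CommutativeRing.semiring laurentRing)

  coeff-sum : ∀ {n} (f : Fin n → Laurent Carrier) k →
    coeff rawRing (Σₗ.sum f) k ≈ Σ.sum (λ i → coeff rawRing (f i) k)
  coeff-sum {zero}  f k = reflexive (coeff-0ₗ k)
  coeff-sum {suc n} f k = trans (coeff-+ₗ (f Fin.zero) (Σₗ.sum (f ∘ Fin.suc)) k) (+-congˡ (coeff-sum (f ∘ Fin.suc) k))

  fromSeries-sum : ∀ {n} (f : Fin n → ℕ → Carrier) →
    Σₗ.sum (λ i → fromSeries (f i)) ≈ₗ fromSeries (λ k → Σ.sum (λ i → f i k))
  fromSeries-sum {zero}  f k = refl
  fromSeries-sum {suc n} f k = begin
    coeff rawRing (fromSeries (f Fin.zero) +ₗ Σₗ.sum (λ i → fromSeries (f (Fin.suc i)))) k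
      ≈⟨ coeff-+ₗ (fromSeries (f Fin.zero)) _ k ⟩
    coeff rawRing (fromSeries (f Fin.zero)) k + coeff rawRing (Σₗ.sum (λ i → fromSeries (f (Fin.suc i)))) k
      ≈⟨ +-congˡ (fromSeries-sum (f ∘ Fin.suc) k) ⟩
    coeff rawRing (fromSeries (f Fin.zero)) k + coeff rawRing (fromSeries g) k
      ≈⟨ coeff-+ₗ (fromSeries (f Fin.zero)) (fromSeries g) k ⟨
    coeff rawRing (fromSeries (f Fin.zero) +ₗ fromSeries g) k
      ≈⟨ fromSeries-⊕ (f Fin.zero) g k ⟩
    coeff rawRing (fromSeries (f Fin.zero ⊕ g)) k ∎
    where
    g : ℕ → Carrier
    g k = Σ.sum (λ i → f (Fin.suc i) k)

  private
    -- The hypothesis on `b ∘ suc` says that b is a polynomial of degree at most 1. The case of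
    -- interest is a coefficient in t of x - X.
    ⊛-linear : ∀ f {b} → b ∘ suc ≋ constant rawRing (b 1) → ∀ n → (f ⊛ b) (suc n) ≈ f (suc n) * b 0 + f n * b 1
    ⊛-linear f {b} p n = begin
      (f ⊛ b) (suc n)                                        ≈⟨ ⊛-sucʳ f b n ⟩
      f (suc n) * b 0 + (f ⊛ (b ∘ suc)) n                    ≈⟨ +-congˡ (⊛-congˡ f p n) ⟩
      f (suc n) * b 0 + (f ⊛ constant rawRing (b 1)) n       ≈⟨ +-congˡ (⊛-comm f (constant rawRing (b 1)) n) ⟩
      f (suc n) * b 0 + (constant rawRing (b 1) ⊛ f) n       ≈⟨ +-congˡ (constant-⊛ (b 1) f n) ⟩
      f (suc n) * b 0 + b 1 * f n                            ≈⟨ +-congˡ (*-comm _ _) ⟩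
      f (suc n) * b 0 + f n * b 1                            ∎

    extend-⊛-linear : ∀ f {b} → b ∘ suc ≋ constant rawRing (b 1) → ∀ k →
      extend (f ⊛ b) (ℤ.suc k) ≈ extend f (ℤ.suc k) * b 0 + extend f k * b 1
    extend-⊛-linear f {b} p (+ n)     = ⊛-linear f {b} p n
    -- At the boundary the product has only the term `f 0 * b 0`; the other term meets the zero
    -- extension of f.
    extend-⊛-linear f p -[1+ zero ]   = +-congˡ (sym (zeroˡ _))
    extend-⊛-linear f p -[1+ suc _ ]  = sym (trans (+-cong (zeroˡ _) (zeroˡ _)) (+-identityʳ _))

  coeff-*ₗ-linear : ∀ e {b} → b ∘ suc ≋ constant rawRing (b 1) → ∀ k →
    coeff rawRing (e *ₗ fromSeries b) (ℤ.suc k) ≈ coeff rawRing e (ℤ.suc k) * b 0 + coeff rawRing e k * b 1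
  coeff-*ₗ-linear e {b} p k = begin
    coeff rawRing (e *ₗ fromSeries b) (ℤ.suc k)
      ≡⟨ coeff-extend (e *ₗ fromSeries b) (ℤ.suc k) ⟩
    extend (series e ⊛ b) (ℤ.suc k ℤ.+ + (pole e ℕ.+ 0))
      ≡⟨ ≡.cong (λ q → extend (series e ⊛ b) (ℤ.suc k ℤ.+ + q)) (ℕ.+-identityʳ (pole e)) ⟩
    extend (series e ⊛ b) (ℤ.suc k ℤ.+ + pole e)
      ≡⟨ ≡.cong (extend (series e ⊛ b)) suc-+ ⟩
    extend (series e ⊛ b) (ℤ.suc (k ℤ.+ + pole e))
      ≈⟨ extend-⊛-linear (series e) {b} p (k ℤ.+ + pole e) ⟩
    extend (series e) (ℤ.suc (k ℤ.+ + pole e)) * b 0 + extend (series e) (k ℤ.+ + pole e) * b 1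
      ≡⟨ ≡.cong₂ (λ u v → u * b 0 + v * b 1)
           (≡.trans (coeff-extend e (ℤ.suc k)) (≡.cong (extend (series e)) suc-+)) (coeff-extend e k) ⟨
    coeff rawRing e (ℤ.suc k) * b 0 + coeff rawRing e k * b 1 ∎
    where
    suc-+ : ℤ.suc k ℤ.+ + pole e ≡ ℤ.suc (k ℤ.+ + pole e)
    suc-+ = ℤ.+-assoc (+ 1) k (+ pole e)

-- Evaluation at X, division by x - X, and the derivative.

module Evaluation {c ℓ : Level} (S : CommutativeRing c ℓ) where
  open CommutativeRing S
  open SetoidReasoning setoid
  open PowerSeriesProperties S
  open SemiringMult semiring using (×-comm-*; ×-congʳ) renaming (_×_ to _·_)
  private
    module + = CommutativeSemigroupProperties +-commutativeSemigroup
    module * = CommutativeSemigroupProperties *-commutativeSemigroup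
    module R = RingProperties ring
    module M = CommutativeMonoidMult +-commutativeMonoid

  -- Evaluation is axiomatised by its Horner step, so that none of the algebra touches truncated
  -- sums. The index type I is left open because uniqueness is applied to families indexed by series
  -- or pairs of series.
  module At
    (X : Carrier)
    (recurrence-unique : ∀ {I : Set c} (next : I → I) (A B C : I → Carrier) →
      (∀ i → A i ≈ C i + X * A (next i)) → (∀ i → B i ≈ C i + X * B (next i)) →
      ∀ i → A i ≈ B i)
    (ev : (ℕ → Carrier) → Carrier)
    (ev-cong : ∀ {F G} → (∀ i → F i ≈ G i) → ev F ≈ ev G)
    (ev-step : ∀ G → ev G ≈ G 0 + X * ev (G ∘ suc))
    where

    ev-⊕ : ∀ F G → ev (F ⊕ G) ≈ ev F + ev G
    ev-⊕ F G = recurrence-unique (λ (F , G) → F ∘ suc , G ∘ suc)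
      (λ (F , G) → ev (F ⊕ G)) (λ (F , G) → ev F + ev G) (λ (F , G) → F 0 + G 0)
      (λ (F , G) → ev-step (F ⊕ G))
      (λ (F , G) → begin
        ev F + ev G                                              ≈⟨ +-cong (ev-step F) (ev-step G) ⟩
        (F 0 + X * ev (F ∘ suc)) + (G 0 + X * ev (G ∘ suc))      ≈⟨ +.interchange _ _ _ _ ⟩
        (F 0 + G 0) + (X * ev (F ∘ suc) + X * ev (G ∘ suc))      ≈⟨ +-congˡ (distribˡ _ _ _) ⟨
        (F 0 + G 0) + X * (ev (F ∘ suc) + ev (G ∘ suc))          ∎)
      (F , G)

    *-step : ∀ a b u → a * (b + X * u) ≈ a * b + X * (a * u)
    *-step a b u = trans (distribˡ _ _ _) (+-congˡ (*.x∙yz≈y∙xz _ _ _))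

    ev-scale : ∀ a F → ev (scale a F) ≈ a * ev F
    ev-scale a F = recurrence-unique (_∘ suc)
      (λ F → ev (scale a F)) (λ F → a * ev F) (λ F → a * F 0)
      (λ F → ev-step (scale a F))
      (λ F → trans (*-congˡ (ev-step F)) (*-step a (F 0) (ev (F ∘ suc))))
      F

    -- With G fixed, F G = F_0 G + x (tail of F) G: both sides solve the recurrence along the tails
    -- of F with inhomogeneous term `F 0 * ev G`.
    ev-⊛ : ∀ F G → ev (F ⊛ G) ≈ ev F * ev G
    ev-⊛ F G = recurrence-unique (_∘ suc)
      (λ F → ev (F ⊛ G)) (λ F → ev F * ev G) (λ F → F 0 * ev G)
      (λ F → begin
        ev (F ⊛ G)
          ≈⟨ ev-step (F ⊛ G) ⟩
        F 0 * G 0 + 0# + X * ev (scale (F 0) (G ∘ suc) ⊕ ((F ∘ suc) ⊛ G))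
          ≈⟨ +-cong (+-identityʳ _) (*-congˡ (trans (ev-⊕ (scale (F 0) (G ∘ suc)) ((F ∘ suc) ⊛ G))
                                                    (+-congʳ (ev-scale (F 0) (G ∘ suc))))) ⟩
        F 0 * G 0 + X * (F 0 * ev (G ∘ suc) + ev ((F ∘ suc) ⊛ G))
          ≈⟨ +-congˡ (distribˡ _ _ _) ⟩
        F 0 * G 0 + (X * (F 0 * ev (G ∘ suc)) + X * ev ((F ∘ suc) ⊛ G))
          ≈⟨ +-assoc _ _ _ ⟨
        F 0 * G 0 + X * (F 0 * ev (G ∘ suc)) + X * ev ((F ∘ suc) ⊛ G)
          ≈⟨ +-congʳ (*-step (F 0) (G 0) (ev (G ∘ suc))) ⟨
        F 0 * (G 0 + X * ev (G ∘ suc)) + X * ev ((F ∘ suc) ⊛ G)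
          ≈⟨ +-congʳ (*-congˡ (ev-step G)) ⟨
        F 0 * ev G + X * ev ((F ∘ suc) ⊛ G) ∎)
      (λ F → begin
        ev F * ev G                                  ≈⟨ *-congʳ (ev-step F) ⟩
        (F 0 + X * ev (F ∘ suc)) * ev G              ≈⟨ distribʳ _ _ _ ⟩
        F 0 * ev G + X * ev (F ∘ suc) * ev G         ≈⟨ +-congˡ (*-assoc _ _ _) ⟩
        F 0 * ev G + X * (ev (F ∘ suc) * ev G)       ∎)
      F

    ev-0ₛ : ev 0ₛ ≈ 0#
    ev-0ₛ = begin
      ev 0ₛ                ≈⟨ ev-cong (λ _ → zeroˡ 0#) ⟨
      ev (scale 0# 0ₛ)     ≈⟨ ev-scale 0# 0ₛ ⟩
      0# * ev 0ₛ           ≈⟨ zeroˡ _ ⟩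
      0#                   ∎

    ev-1ₛ : ev 1ₛ ≈ 1#
    ev-1ₛ = begin
      ev 1ₛ            ≈⟨ ev-step 1ₛ ⟩
      1# + X * ev 0ₛ   ≈⟨ +-congˡ (trans (*-congˡ ev-0ₛ) (zeroʳ X)) ⟩
      1# + 0#          ≈⟨ +-identityʳ _ ⟩
      1#               ∎

    -- The Horner remainders Σ_{i ≥ k} G_i X^(i-k). Those with k ≥ 1 are the coefficients of the
    -- quotient of G by x - X, as in synthetic division.
    evTail : (ℕ → Carrier) → ℕ → Carrier
    evTail G zero    = ev G
    evTail G (suc k) = evTail (G ∘ suc) k

    evTail-step : ∀ G k → evTail G k ≈ G k + X * evTail G (suc k)
    evTail-step G zero    = ev-step G
    evTail-step G (suc k) = evTail-step (G ∘ suc) k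

    x-X : ℕ → Carrier
    x-X zero    = - X
    x-X (suc k) = 1ₛ k

    ev-x-X : ev x-X ≈ 0#
    ev-x-X = begin
      ev x-X           ≈⟨ ev-step x-X ⟩
      - X + X * ev 1ₛ  ≈⟨ +-congˡ (trans (*-congˡ ev-1ₛ) (*-identityʳ X)) ⟩
      - X + X          ≈⟨ -‿inverseˡ X ⟩
      0#               ∎

    x-X⊛-zero : ∀ F → (x-X ⊛ F) 0 ≈ - X * F 0
    x-X⊛-zero F = +-identityʳ _

    x-X⊛-suc : ∀ F k → (x-X ⊛ F) (suc k) ≈ - X * F (suc k) + F k
    x-X⊛-suc F k = +-congˡ (⊛-identityˡ F k)

    quotient : (ℕ → Carrier) → ℕ → Carrier
    quotient G k = evTail G (suc k)

    private
      cancel-step : ∀ {a b u} → a ≈ b + X * u → - X * u + a ≈ b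
      cancel-step {a} {b} {u} p = begin
        - X * u + a              ≈⟨ +-congˡ (trans p (+-comm _ _)) ⟩
        - X * u + (X * u + b)    ≈⟨ +-assoc _ _ _ ⟨
        - X * u + X * u + b      ≈⟨ +-congʳ (+-congʳ (R.-‿distribˡ-* X u)) ⟨
        - (X * u) + X * u + b    ≈⟨ +-congʳ (-‿inverseˡ _) ⟩
        0# + b                   ≈⟨ +-identityˡ b ⟩
        b                        ∎

    quotient-step : ∀ G k → - X * quotient G (suc k) + quotient G k ≈ G (suc k)
    quotient-step G k = cancel-step (evTail-step G (suc k))

    -- The remainder of synthetic division by x - X is `ev G`. It occurs only in the constant
    -- coefficient, where the hypothesis lets it be inserted for `0#`.
    factor : ∀ G → ev G ≈ 0# → x-X ⊛ quotient G ≋ G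
    factor G ev≈0 zero    = begin
      (x-X ⊛ quotient G) 0             ≈⟨ x-X⊛-zero (quotient G) ⟩
      - X * quotient G 0               ≈⟨ +-identityʳ _ ⟨
      - X * quotient G 0 + 0#          ≈⟨ +-congˡ ev≈0 ⟨
      - X * quotient G 0 + ev G        ≈⟨ cancel-step (ev-step G) ⟩
      G 0                              ∎
    factor G ev≈0 (suc k) = trans (x-X⊛-suc (quotient G) k) (quotient-step G k)

    derivative : (ℕ → Carrier) → ℕ → Carrier
    derivative G k = suc k · G (suc k)

    -- The product rule for G = (x - X) quotient G + ev G.
    derivative-quotient : ∀ G → derivative G ≋ quotient G ⊕ (x-X ⊛ derivative (quotient G))
    derivative-quotient G k = trans (×-congʳ (suc k) (sym (quotient-step G k))) (trans (expand k) (collect k))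
      where
      H : ℕ → Carrier
      H = quotient G

      expand : ∀ k → suc k · (- X * H (suc k) + H k) ≈ H k + (- X * (suc k · H (suc k)) + k · H k)
      expand k = begin
        suc k · (- X * H (suc k) + H k)                    ≈⟨ M.×-distrib-+ _ _ (suc k) ⟩
        suc k · (- X * H (suc k)) + (H k + k · H k)        ≈⟨ +.x∙yz≈y∙xz _ _ _ ⟩
        H k + (suc k · (- X * H (suc k)) + k · H k)        ≈⟨ +-congˡ (+-congʳ (×-comm-* (suc k) _ _)) ⟨
        H k + (- X * (suc k · H (suc k)) + k · H k)        ∎

      collect : ∀ k → H k + (- X * (suc k · H (suc k)) + k · H k) ≈ (H ⊕ (x-X ⊛ derivative H)) k
      collect zero    = refl
      collect (suc k) = +-congˡ (sym (x-X⊛-suc (derivative H) k))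

    -- In the product rule the term with the factor x - X vanishes at X, and the remainder `ev G`,
    -- constant in x, has derivative zero.
    ev-derivative : ∀ G → ev (derivative G) ≈ ev (quotient G)
    ev-derivative G = begin
      ev (derivative G)                               ≈⟨ ev-cong (derivative-quotient G) ⟩
      ev (H ⊕ (x-X ⊛ derivative H))                   ≈⟨ ev-⊕ H (x-X ⊛ derivative H) ⟩
      ev H + ev (x-X ⊛ derivative H)                  ≈⟨ +-congˡ (ev-⊛ x-X (derivative H)) ⟩
      ev H + ev x-X * ev (derivative H)               ≈⟨ +-congˡ (trans (*-congʳ ev-x-X) (zeroˡ _)) ⟩
      ev H + 0#                                       ≈⟨ +-identityʳ _ ⟩
      ev H                                            ∎
      where
      H : ℕ → Carrier
      H = quotient G

-- Substitution of X into series in K[[x,t]].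

module AtProperties {c ℓ₁ ℓ₂ : Level} (K : HeytingField c ℓ₁ ℓ₂) where
  open Series K using (tK⟦t⟧; value; constant≈0; _at_; K⟦x,t⟧; ∂x)

  R : CommutativeRing c ℓ₁
  R = HeytingCommutativeRing.commutativeRing (HeytingField.heytingCommutativeRing K)

  open CommutativeRing R
  open PowerSeriesProperties R
  open SetoidReasoning setoid

  -- K[[t]]
  S : CommutativeRing c ℓ₁
  S = powerSeriesRing

  private
    module S = CommutativeRing S
    module Σ = SemiringSum semiring
    module Σₛ = SemiringSum S.semiring
    open RawSemiringDefinitions (RawRing.rawSemiring S.rawRing) using (_^_) renaming (_×_ to _·ₛ_)
    open RawSemiringDefinitions (RawRing.rawSemiring rawRing) using () renaming (_×_ to _·_)

  sum-pointwise : ∀ {m} (f : Fin m → S.Carrier) n → Σₛ.sum f n ≡ Σ.sum (λ i → f i n)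
  sum-pointwise {zero}  f n = ≡.refl
  sum-pointwise {suc m} f n = ≡.cong₂ _+_ ≡.refl (sum-pointwise (f ∘ Fin.suc) n)

  ·-pointwise : ∀ k f (n : ℕ) → (k ·ₛ f) n ≡ k · f n
  ·-pointwise zero    f n = ≡.refl
  ·-pointwise (suc k) f n = ≡.cong₂ _+_ ≡.refl (·-pointwise k f n)

  at-0 : ∀ G X → (G at X) 0 ≈ G 0 0
  at-0 G X = trans (+-identityʳ _) (trans (+-identityʳ _) (*-identityʳ _))

  at-cong : ∀ {F G} X → (∀ i → F i ≋ G i) → F at X ≋ G at X
  at-cong {F} {G} X p n = Σ.sum-cong-≋ {n = suc n} λ i →
    ⊛-cong {F (toℕ i)} {G (toℕ i)} {value X ^ toℕ i} (p (toℕ i)) (λ _ → refl) n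

  ^-cong-[<] : ∀ n {f g} → f ≈[< n ] g → ∀ i → (f ^ i) ≈[< n ] (g ^ i)
  ^-cong-[<] n p zero    = λ _ _ → refl
  ^-cong-[<] n {f} {g} p (suc i) = ⊛-cong-[<] n {f} {g} p (^-cong-[<] n p i)

  at-cong-[<] : ∀ n {X Y} → value X ≈[< n ] value Y → ∀ G → (G at X) ≈[< n ] (G at Y)
  at-cong-[<] n {X} {Y} p G m m<n = Σ.sum-cong-≋ {n = suc m} λ i →
    ⊛-cong-[<] n {G (toℕ i)} {G (toℕ i)} {value X ^ toℕ i} {value Y ^ toℕ i}
      (λ _ _ → refl) (^-cong-[<] n p (toℕ i)) m m<n

  module _ (X : tK⟦t⟧) where

    private
      χ : S.Carrier
      χ = value X

      -- In `_at_` the number of summands grows with the coefficient, so it is not one finite sum in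
      -- K[[t]]. These truncations are, and the ring laws apply to them.
      partialAt : ℕ → K⟦x,t⟧ → S.Carrier
      partialAt n G = Σₛ.sum {n} (λ i → G (toℕ i) ⊛ (χ ^ toℕ i))

      at-partial : ∀ G n → (G at X) n ≈ partialAt (suc n) G n
      at-partial G n = reflexive (≡.sym (sum-pointwise {suc n} (λ i → G (toℕ i) ⊛ (χ ^ toℕ i)) n))

      partialAt-suc : ∀ n G → partialAt (suc n) G ≋ G 0 ⊕ (χ ⊛ partialAt n (G ∘ suc))
      partialAt-suc n G = S.+-cong {G 0 ⊛ 1ₛ} {G 0}
        (S.*-identityʳ (G 0))
        (S.trans {Σₛ.sum (λ (i : Fin n) → G (suc (toℕ i)) ⊛ (χ ⊛ (χ ^ toℕ i)))}
          (Σₛ.sum-cong-≋ {n} {λ i → G (suc (toℕ i)) ⊛ (χ ⊛ (χ ^ toℕ i))} {λ i → χ ⊛ (G (suc (toℕ i)) ⊛ (χ ^ toℕ i))}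
            (λ i → x∙yz≈y∙xz (G (suc (toℕ i))) χ (χ ^ toℕ i)))
          (S.sym {χ ⊛ partialAt n (G ∘ suc)} (Σₛ.*-distribˡ-sum χ (λ (i : Fin n) → G (suc (toℕ i)) ⊛ (χ ^ toℕ i)))))
        where open CommutativeSemigroupProperties S.*-commutativeSemigroup using (x∙yz≈y∙xz)

      -- Every term in which the truncations differ contains X to a power at least n, hence t^n;
      -- each induction step extracts one factor X.
      partialAt-stable : ∀ n {k l} G → n ℕ.≤ k → n ℕ.≤ l → partialAt k G ≈[< n ] partialAt l G
      partialAt-stable (suc n) {suc k} {suc l} G (s≤s n≤k) (s≤s n≤l) m (s≤s m≤n) = begin
        partialAt (suc k) G m                           ≈⟨ partialAt-suc k G m ⟩
        G 0 m + (χ ⊛ partialAt k (G ∘ suc)) m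
          ≈⟨ +-congˡ (⊛-cong-< χ m (constant≈0 X) λ i i<m →
               partialAt-stable n (G ∘ suc) n≤k n≤l i (ℕ.<-≤-trans i<m m≤n)) ⟩
        G 0 m + (χ ⊛ partialAt l (G ∘ suc)) m           ≈⟨ partialAt-suc l G m ⟨
        partialAt (suc l) G m                           ∎

    at-step : ∀ G → G at X ≋ G 0 ⊕ (χ ⊛ ((G ∘ suc) at X))
    at-step G n = begin
      (G at X) n                                   ≈⟨ at-partial G n ⟩
      partialAt (suc n) G n                        ≈⟨ partialAt-suc n G n ⟩
      G 0 n + (χ ⊛ partialAt n (G ∘ suc)) n
        -- Under the factor χ only coefficients m < n matter. There `_at_` sums `suc m` terms and
        -- the truncation n terms, and both suffice modulo t^(m+1).
        ≈⟨ +-congˡ (⊛-cong-< χ n (constant≈0 X) λ m m<n →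
             trans (partialAt-stable (suc m) (G ∘ suc) m<n ℕ.≤-refl m ℕ.≤-refl)
                   (sym (at-partial (G ∘ suc) m))) ⟩
      G 0 n + (χ ⊛ ((G ∘ suc) at X)) n             ∎

    private
      at-recurrence-unique : ∀ {I : Set c} (next : I → I) (A B C : I → S.Carrier) →
        (∀ i → A i ≋ C i ⊕ (χ ⊛ A (next i))) → (∀ i → B i ≋ C i ⊕ (χ ⊛ B (next i))) →
        ∀ i → A i ≋ B i
      at-recurrence-unique next = recurrence-unique next {χ} (constant≈0 X)

      at-congX : ∀ {F G} → (∀ i → F i ≋ G i) → F at X ≋ G at X
      at-congX {F} {G} = at-cong {F} {G} X

    open Evaluation.At S χ at-recurrence-unique (_at X) at-congX at-step public

    ∂x-derivative : ∀ G k → ∂x G k ≋ derivative G k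
    ∂x-derivative G k n = reflexive (≡.sym (·-pointwise (suc k) (G (suc k)) n))

  -- Existence and uniqueness of the root X.

  module Root (G : K⟦x,t⟧) (G₀₀≈0 : G 0 0 ≈ 0#) (V : S.Carrier) (V-inverse : G 1 ⊛ V ≋ 1ₛ) where

    private
      w : tK⟦t⟧ → S.Carrier
      w X = (G ∘ suc ∘ suc) at X

      step : tK⟦t⟧ → S.Carrier
      step X = V ⊛ (⊝ (G 0 ⊕ (value X ⊛ (value X ⊛ w X))))

      at-step² : ∀ X → G at X ≋ G 0 ⊕ (value X ⊛ (G 1 ⊕ (value X ⊛ w X)))
      at-step² X n = trans (at-step X G n) (+-congˡ (⊛-congˡ (value X) (at-step X (G ∘ suc)) n))

      open RootEquation S

      root⇒step : ∀ X → G at X ≋ 0ₛ → value X ≋ step X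
      root⇒step X eq = root⇒fixpoint {G 0} {G 1} {V} V-inverse (value X) (w X)
        (λ n → trans (sym (at-step² X n)) (eq n))

      step⇒root : ∀ X → value X ≋ step X → G at X ≋ 0ₛ
      step⇒root X eq n = trans (at-step² X n)
        (fixpoint⇒root {G 0} {G 1} {V} V-inverse (value X) (w X) eq n)

      -- Writing the unknown as X = tZ leaves Z unconstrained, so the fixed point theorem for
      -- arbitrary series applies.
      ⟨t·_⟩ : S.Carrier → tK⟦t⟧
      ⟨t· Z ⟩ = record { value = shift Z ; constant≈0 = refl }

      t²-factor : ∀ Z u → shift Z ⊛ (shift Z ⊛ u) ≋ shift^ 2 (Z ⊛ (Z ⊛ u))
      t²-factor Z u n = begin
        (shift Z ⊛ (shift Z ⊛ u)) n      ≈⟨ shift-⊛ Z (shift Z ⊛ u) n ⟩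
        shift (Z ⊛ (shift Z ⊛ u)) n      ≈⟨ shift-cong (⊛-congˡ Z (shift-⊛ Z u)) n ⟩
        shift (Z ⊛ shift (Z ⊛ u)) n      ≈⟨ shift-cong (⊛-shift^ 1 Z (Z ⊛ u)) n ⟩
        shift^ 2 (Z ⊛ (Z ⊛ u)) n         ∎

      -- The square X² = t² Z² gains two orders. Dividing by t to return to Z costs one, and the
      -- other makes `Φ` a contraction.
      step-cong-[<] : ∀ n {Y Z} → Y ≈[< n ] Z → step ⟨t· Y ⟩ ≈[< suc (suc n) ] step ⟨t· Z ⟩
      step-cong-[<] n {Y} {Z} p = ⊛-cong-[<] (suc (suc n)) {V} (λ _ _ → refl)
        (λ m m<n → -‿cong (+-congˡ (begin
          (shift Y ⊛ (shift Y ⊛ w ⟨t· Y ⟩)) m    ≈⟨ t²-factor Y (w ⟨t· Y ⟩) m ⟩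
          shift^ 2 (Y ⊛ (Y ⊛ w ⟨t· Y ⟩)) m       ≈⟨ shift-cong-[<] (suc n) (shift-cong-[<] n
                                                      (⊛-cong-[<] n {Y} {Z} p (⊛-cong-[<] n {Y} {Z} p w-cong))) m m<n ⟩
          shift^ 2 (Z ⊛ (Z ⊛ w ⟨t· Z ⟩)) m       ≈⟨ t²-factor Z (w ⟨t· Z ⟩) m ⟨
          (shift Z ⊛ (shift Z ⊛ w ⟨t· Z ⟩)) m    ∎)))
        where
        w-cong : w ⟨t· Y ⟩ ≈[< n ] w ⟨t· Z ⟩
        w-cong m m<n = at-cong-[<] (suc n) {⟨t· Y ⟩} {⟨t· Z ⟩} (shift-cong-[<] n p) (G ∘ suc ∘ suc) m (ℕ.m<n⇒m<1+n m<n)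

      Φ : S.Carrier → S.Carrier
      Φ Z = step ⟨t· Z ⟩ ∘ suc

      contraction : Contraction Φ
      contraction n p = step-cong-[<] n p (suc n) ℕ.≤-refl

      -- Here G(0,0) = 0 enters: `step X` is divisible by t, so the division by t in `Φ` loses
      -- nothing and its fixed points give roots.
      step-0 : ∀ X → step X 0 ≈ 0#
      step-0 X = trans (S.*-comm V (⊝ Y) 0) (⊛-0 (⊝ Y) V (begin
        - (G 0 0 + (value X ⊛ (value X ⊛ w X)) 0)
          ≈⟨ -‿cong (+-cong G₀₀≈0 (⊛-0 (value X) (value X ⊛ w X) (constant≈0 X))) ⟩
        - (0# + 0#)                                 ≈⟨ -‿cong (+-identityʳ _) ⟩
        - 0#                                        ≈⟨ RingProperties.-0#≈0# ring ⟩
        0#                                          ∎))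
        where
        Y : S.Carrier
        Y = G 0 ⊕ (value X ⊛ (value X ⊛ w X))

      root⇒fixed : ∀ X → G at X ≋ 0ₛ → value X ∘ suc ≋ Φ (value X ∘ suc)
      root⇒fixed X eq n = root⇒step X′ eq′ (suc n)
        where
        -- The constant terms of `X` and `X′` agree only up to `≈`, so the property of being a root
        -- has to be transported.
        X′ : tK⟦t⟧
        X′ = ⟨t· value X ∘ suc ⟩

        eq′ : G at X′ ≋ 0ₛ
        eq′ m = trans (at-cong-[<] (suc m) {X′} {X} (λ k _ → sym (shift-tail {value X} (constant≈0 X) k)) G m ℕ.≤-refl) (eq m)

    private
      fixed⇒root : ∀ {Z} → Z ≋ Φ Z → G at ⟨t· Z ⟩ ≋ 0ₛ
      fixed⇒root {Z} p = step⇒root ⟨t· Z ⟩ λ where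
        zero    → sym (step-0 ⟨t· Z ⟩)
        (suc n) → p n

      fixed-unique : ∀ {Z} → Z ≋ Φ Z → ∀ {Y} → G at Y ≋ 0ₛ → shift Z ≋ value Y
      fixed-unique {Z} p {Y} eq zero    = sym (constant≈0 Y)
      fixed-unique {Z} p {Y} eq (suc n) = fixpoint-unique {Φ} contraction {Z} {value Y ∘ suc} p (root⇒fixed Y eq) n

    root-∃! : ∃! (λ X Y → value X ≋ value Y) (λ X → G at X ≋ 0ₛ)
    root-∃! = let Z , p = fixpoint {Φ} contraction in
      ⟨t· Z ⟩ , fixed⇒root {Z} p , λ {Y} → fixed-unique {Z} p {Y}

-- Identities in commutative rings.

module Rearrangements {c ℓ : Level} (R : CommutativeRing c ℓ) where
  open CommutativeRing R
  open SetoidReasoning setoid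
  open RingProperties ring
  private
    module * = CommutativeSemigroupProperties *-commutativeSemigroup

  -- Meant for y = 1/G, l = x - X and Q = F / H: regrouping l with H restores G, which cancels y, so
  -- there is no division by x - X.
  cancel-inverse : ∀ x y l G H F Q → G * y ≈ 1# → l * H ≈ G → H * Q ≈ F →
    ((x * y) * F) * l ≈ x * Q
  cancel-inverse x y l G H F Q Gy≈1 lH≈G HQ≈F = begin
    ((x * y) * F) * l            ≈⟨ *-congʳ (*-congˡ HQ≈F) ⟨
    ((x * y) * (H * Q)) * l      ≈⟨ *-assoc _ _ _ ⟩
    (x * y) * ((H * Q) * l)      ≈⟨ *-assoc _ _ _ ⟩
    x * (y * ((H * Q) * l))      ≈⟨ *-congˡ (*-congˡ (*.xy∙z≈zx∙y H Q l)) ⟩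
    x * (y * ((l * H) * Q))      ≈⟨ *-congˡ (*-assoc _ _ _) ⟨
    x * (y * (l * H) * Q)        ≈⟨ *-congˡ (*-congʳ (trans (*-congˡ lH≈G) (trans (*-comm _ _) Gy≈1))) ⟩
    x * (1# * Q)                 ≈⟨ *-congˡ (*-identityˡ Q) ⟩
    x * Q                        ∎

  -- Meant for u = E_k, v = E_{k+1} and w = Q_k; the factors `- X` and `1#` are the two coefficients
  -- of x - X.
  isolate : ∀ X u v w → v * - X + u * 1# ≈ w → u ≈ w + X * v
  isolate X u v w eq = begin
    u                            ≈⟨ +-identityˡ u ⟨
    0# + u                       ≈⟨ +-congʳ (-‿inverseʳ (X * v)) ⟨
    X * v + - (X * v) + u        ≈⟨ +-assoc _ _ _ ⟩
    X * v + (- (X * v) + u)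
      ≈⟨ +-congˡ (+-cong (trans (-‿cong (*-comm X v)) (-‿distribʳ-* v X)) (sym (*-identityʳ u))) ⟩
    X * v + (v * - X + u * 1#)   ≈⟨ +-congˡ eq ⟩
    X * v + w                    ≈⟨ +-comm _ _ ⟩
    w + X * v                    ∎

  divide : ∀ q h f d v → h * q ≈ f → d ≈ h → d * v ≈ 1# → q ≈ f * v
  divide q h f d v hq≈f d≈h dv≈1 = begin
    q              ≈⟨ *-identityʳ q ⟨
    q * 1#         ≈⟨ *-congˡ dv≈1 ⟨
    q * (d * v)    ≈⟨ *-congˡ (*-congʳ d≈h) ⟩
    q * (h * v)    ≈⟨ *.x∙yz≈yx∙z q h v ⟩
    h * q * v      ≈⟨ *-congʳ hq≈f ⟩
    f * v          ∎

-- K[[x,t]] inside K((x))((t)), and coefficients of powers of x.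

module Embedding {c ℓ₁ ℓ₂ : Level} (K : HeytingField c ℓ₁ ℓ₂) where
  open Series K using (tK⟦t⟧; value; constant≈0; _at_; embed; x; K⟨⟨x⟩⟩⟨⟨t⟩⟩)
  open AtProperties K
  open CommutativeRing R
  open PowerSeriesProperties R
  open SetoidReasoning setoid
  open LaurentProperties R using (laurentRing; coeff-fromSeries; coeff-sum; fromSeries-sum; coeff-*ₗ-linear; coeff-0ₗ; ≋⇒≈ₗ)

  -- K((x)) and K((x))((t))
  L LL : CommutativeRing c ℓ₁
  L  = laurentRing
  LL = LaurentProperties.laurentRing L

  module L  = CommutativeRing L
  module LL = CommutativeRing LL
  module PS = PowerSeriesProperties S
  module PL = PowerSeriesProperties L
  module LP = LaurentProperties L
  private
    module Σ = SemiringSum semiring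

  embed-cong : ∀ {F G} → F PS.≋ G → embed F LL.≈ embed G
  embed-cong {F} {G} p = LP.≋⇒≈ₗ-pole {embed F} {embed G} ≡.refl λ j →
    LaurentProperties.≋⇒≈ₗ-pole R {fromSeries (λ i → F i j)} {fromSeries (λ i → G i j)} ≡.refl λ i → p i j

  -- The outer index is x in K[[x,t]] but t in K((x))((t)), so the two products are the same double
  -- sum in opposite orders.
  embed-⊛ : ∀ F G → embed F LL.* embed G LL.≈ embed (F PS.⊛ G)
  embed-⊛ F G = LP.≋⇒≈ₗ-pole {embed F LL.* embed G} {embed (F PS.⊛ G)} ≡.refl λ n →
    L.trans {(series (embed F) PL.⊛ series (embed G)) n} {fromSeries (total n)} {fromSeries (λ i → (F PS.⊛ G) i n)}
      (fromSeries-sum {suc n} (λ j → (λ i → F i (toℕ j)) ⊛ (λ i → G i (n ∸ toℕ j))))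
      (LaurentProperties.≋⇒≈ₗ-pole R {fromSeries (total n)} {fromSeries (λ i → (F PS.⊛ G) i n)} ≡.refl (swap n))
    where
    total : ℕ → ℕ → Carrier
    total n i = Σ.sum {suc n} (λ j → Σ.sum {suc i} (λ k → F (toℕ k) (toℕ j) * G (i ∸ toℕ k) (n ∸ toℕ j)))

    swap : ∀ n i → total n i ≈ (F PS.⊛ G) i n
    swap n i = trans
      (Σ.∑-comm {suc n} {suc i} (λ j k → F (toℕ k) (toℕ j) * G (i ∸ toℕ k) (n ∸ toℕ j)))
      (reflexive (≡.sym (sum-pointwise {suc i} (λ k → F (toℕ k) ⊛ G (i ∸ toℕ k)) n)))

  -- As a series in t over K((x)), G has constant coefficient G(x,0), which is x times a unit of
  -- K[[x]] and hence invertible in K((x)).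
  embed-invertible : ∀ G → G 0 0 ≈ 0# → ∀ u → G 1 0 * u ≈ 1# → Invertible K⟨⟨x⟩⟩⟨⟨t⟩⟩ (embed G)
  embed-invertible G G₀₀≈0 u G₁₀u≈1 =
    h , LL.trans {h LL.* embed G} {embed G LL.* h} {LL.1#} (LL.*-comm h (embed G)) right , right
    where
    g : ℕ → Carrier
    g i = G i 0

    v : ℕ → Carrier
    v = proj₁ (inverse (g ∘ suc) u G₁₀u≈1)

    -- These are series in x; the `t` of the name is the generic variable. Since v inverts G(x,0)/x,
    -- the inverse of G(x,0) is v/x, whence the pole 1 of `1/g`.
    g⊛v≋t : g ⊛ v ≋ shift 1ₛ
    g⊛v≋t n = begin
      (g ⊛ v) n                    ≈⟨ ⊛-cong {g} {shift (g ∘ suc)} {v} (shift-tail {g} G₀₀≈0) (λ _ → refl) n ⟩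
      (shift (g ∘ suc) ⊛ v) n      ≈⟨ shift-⊛ (g ∘ suc) v n ⟩
      shift ((g ∘ suc) ⊛ v) n      ≈⟨ shift-cong (proj₂ (inverse (g ∘ suc) u G₁₀u≈1)) n ⟩
      shift 1ₛ n                   ∎

    1/g : L.Carrier
    1/g = laurent 1 v

    PL-inverse : ∃ λ h → series (embed G) PL.⊛ h PL.≋ PL.1ₛ
    PL-inverse = PL.inverse (series (embed G)) 1/g (≋⇒≈ₗ {fromSeries g L.* 1/g} {L.1#} g⊛v≋t)

    h : LL.Carrier
    h = fromSeries (proj₁ PL-inverse)

    right : embed G LL.* h LL.≈ LL.1#
    right = LP.≋⇒≈ₗ-pole {embed G LL.* h} {LL.1#} ≡.refl (proj₂ PL-inverse)

  -- The coefficient of x^k multiplied by t^(pole f). Dropping the pole puts it in K[[t]], where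
  -- recurrences have unique solutions; for k = 0 it is the series of `CTₓ f`.
  slice : ℕ → LL.Carrier → ℕ → Carrier
  slice k f n = coeff rawRing (series f n) (+ k)

  slice-shift^ : ∀ k p (f : ℕ → L.Carrier) n →
    coeff rawRing (PL.shift^ p f n) (+ k) ≈ shift^ p (λ m → coeff rawRing (f m) (+ k)) n
  slice-shift^ k zero    f n       = refl
  slice-shift^ k (suc p) f zero    = reflexive (coeff-0ₗ (+ k))
  slice-shift^ k (suc p) f (suc n) = slice-shift^ k p f n

  slice-x* : ∀ Q k → slice (suc k) (x LL.* embed Q) ≋ Q k
  slice-x* Q k n = begin
    coeff rawRing (series (x LL.* embed Q) n) (+ suc k)
      ≈⟨ PL.constant-⊛ (fromSeries ξ) (series (embed Q)) n (+ suc k) ⟩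
    coeff rawRing (fromSeries (ξ ⊛ (λ i → Q i n))) (+ suc k)  ≡⟨ coeff-fromSeries (ξ ⊛ (λ i → Q i n)) (suc k) ⟩
    (ξ ⊛ (λ i → Q i n)) (suc k)                               ≈⟨ ⊛-suc ξ (λ i → Q i n) k refl ⟩
    ((ξ ∘ suc) ⊛ (λ i → Q i n)) k
      ≈⟨ ⊛-cong {ξ ∘ suc} {1ₛ} {λ i → Q i n} ξ-tail (λ _ → refl) k ⟩
    (1ₛ ⊛ (λ i → Q i n)) k                                    ≈⟨ ⊛-identityˡ (λ i → Q i n) k ⟩
    Q k n                                                     ∎
    where
    ξ : ℕ → Carrier
    ξ = series (series x 0)

    ξ-tail : ξ ∘ suc ≋ 1ₛ
    ξ-tail zero    = refl
    ξ-tail (suc _) = refl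

  module _ (X : tK⟦t⟧) where

    -- Each coefficient in t of x - X is linear in x, so each summand splits in two, and the two
    -- sums are Cauchy products in t. At x^(k+1) only E_k and E_{k+1} contribute, so the poles of E
    -- in x do not enter.
    slice-*x-X : ∀ E k → slice (suc k) (E LL.* embed (x-X X)) ≋
      (slice (suc k) E ⊛ (⊝ value X)) ⊕ (slice k E ⊛ 1ₛ)
    slice-*x-X E k n = begin
      coeff rawRing (series (E LL.* embed (x-X X)) n) (+ suc k)
        ≈⟨ coeff-sum {suc n} (λ i → series E (toℕ i) L.* series (embed (x-X X)) (n ∸ toℕ i)) (+ suc k) ⟩
      Σ.sum {suc n} (λ i → coeff rawRing (series E (toℕ i) L.* series (embed (x-X X)) (n ∸ toℕ i)) (+ suc k))
        ≈⟨ Σ.sum-cong-≋ {suc n} (λ i → coeff-*ₗ-linear (series E (toℕ i)) {λ j → x-X X j (n ∸ toℕ i)}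
             (x-X-linear (n ∸ toℕ i)) (+ k)) ⟩
      Σ.sum {suc n} (λ i → slice (suc k) E (toℕ i) * (⊝ value X) (n ∸ toℕ i) + slice k E (toℕ i) * 1ₛ (n ∸ toℕ i))
        ≈⟨ Σ.∑-distrib-+ {suc n} (λ i → slice (suc k) E (toℕ i) * (⊝ value X) (n ∸ toℕ i)) (λ i → slice k E (toℕ i) * 1ₛ (n ∸ toℕ i)) ⟩
      (slice (suc k) E ⊛ (⊝ value X)) n + (slice k E ⊛ 1ₛ) n ∎
      where
      x-X-linear : ∀ j → (λ i → x-X X (suc i) j) ≋ constant rawRing (x-X X 1 j)
      x-X-linear j zero    = refl
      x-X-linear j (suc _) = refl

    -- The slices of E and the Horner remainders of Q, multiplied by t^p, solve the same recurrence.
    -- At k = 0 the remainder is Q(X,t).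
    slice-0 : ∀ E Q → E LL.* embed (x-X X) LL.≈ x LL.* embed Q → slice 0 E ≋ shift^ (pole E ℕ.+ 0) (Q at X)
    slice-0 E Q eq = recurrence-unique suc {value X} (constant≈0 X)
      (λ k → slice k E) (λ k → shift^ p (evTail X Q k)) (λ k → shift^ p (Q k)) recE recQ 0
      where
      -- The `0` is the pole of `embed (x-X X)`; it is kept so that p is definitionally the pole of
      -- the product.
      p : ℕ
      p = pole E ℕ.+ 0

      recE : ∀ k → slice k E ≋ shift^ p (Q k) ⊕ (value X ⊛ slice (suc k) E)
      recE k = Rearrangements.isolate S (value X) (slice k E) (slice (suc k) E) (shift^ p (Q k)) λ n → begin
        (slice (suc k) E ⊛ (⊝ value X)) n + (slice k E ⊛ 1ₛ) n          ≈⟨ slice-*x-X E k n ⟨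
        slice (suc k) (E LL.* embed (x-X X)) n
          ≈⟨ LP.≈ₗ⇒≋ {E LL.* embed (x-X X)} {x LL.* embed Q} eq n (+ suc k) ⟩
        coeff rawRing (PL.shift^ p (series (x LL.* embed Q)) n) (+ suc k)
          ≈⟨ slice-shift^ (suc k) p (series (x LL.* embed Q)) n ⟩
        shift^ p (slice (suc k) (x LL.* embed Q)) n                     ≈⟨ shift^-cong p (slice-x* Q k) n ⟩
        shift^ p (Q k) n                                                ∎

      recQ : ∀ k → shift^ p (evTail X Q k) ≋ shift^ p (Q k) ⊕ (value X ⊛ shift^ p (evTail X Q (suc k)))
      recQ k n = begin
        shift^ p (evTail X Q k) n
          ≈⟨ shift^-cong p (evTail-step X Q k) n ⟩
        shift^ p (Q k ⊕ (value X ⊛ evTail X Q (suc k))) n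
          ≈⟨ shift^-⊕ p (Q k) (value X ⊛ evTail X Q (suc k)) n ⟩
        shift^ p (Q k) n + shift^ p (value X ⊛ evTail X Q (suc k)) n
          ≈⟨ +-congˡ (⊛-shift^ p (value X) (evTail X Q (suc k)) n) ⟨
        shift^ p (Q k) n + (value X ⊛ shift^ p (evTail X Q (suc k))) n      ∎

-- The constant term of x F / G.

module Residue {c ℓ₁ ℓ₂ : Level} (K : HeytingField c ℓ₁ ℓ₂) where
  open Series K
  open AtProperties K using (R; S; at-0; quotient; factor; x-X; ev-derivative; ev-⊛; derivative; at-cong; ∂x-derivative)
  open CommutativeRing R using (_*_; 1#; refl; trans; sym; *-congʳ; +-identityʳ)
  open PowerSeriesProperties R using (inverse; _≋_; 1ₛ; _⊛_; shift^; shift^-cong)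
  open Embedding K using (LL; module LL; embed-⊛; embed-cong; slice; slice-0)
  private
    module S = CommutativeRing S
    module PS = PowerSeriesProperties S

  -- As X has no constant term, that of ∂G/∂x at X is `∂x G 0 0`, the multiple `1 × G 1 0`, which
  -- unfolds to `G 1 0 + 0#`.
  ∂x-at-invertible : ∀ G u → G 1 0 * u ≈ 1# → ∀ X → Invertible K⟦t⟧ (∂x G at X)
  ∂x-at-invertible G u G₁₀u≈1 X =
    let v , right = inverse (∂x G at X) u
          (trans (*-congʳ (trans (at-0 (∂x G) X) (+-identityʳ (G 1 0)))) G₁₀u≈1)
    in v , (λ n → trans (S.*-comm v (∂x G at X) n) (right n)) , right

  module _ (G F : K⟦x,t⟧) (u : Carrier) (G₁₀u≈1 : G 1 0 * u ≈ 1#)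
    (X : tK⟦t⟧) (root : (G at X) K⟦t⟧.≈ K⟦t⟧.0#) where

    private
      H : K⟦x,t⟧
      H = quotient X G

      -- Inversion goes through both variables: `G 1 0` is the constant term of `H 0` in K[[t]], and
      -- `H 0` is that of H as a series in x over K[[t]].
      H₀-inverse : ∃ λ v → H 0 ⊛ v ≋ 1ₛ
      H₀-inverse = inverse (H 0) u (trans (*-congʳ (at-0 (λ i → G (suc i)) X)) G₁₀u≈1)

      H-inverse : ∃ λ V → H PS.⊛ V PS.≋ PS.1ₛ
      H-inverse = PS.inverse H (proj₁ H₀-inverse) (proj₂ H₀-inverse)

      Q : K⟦x,t⟧
      Q = proj₁ H-inverse PS.⊛ F

      HQ≋F : H PS.⊛ Q PS.≋ F
      HQ≋F k = S.trans {(H PS.⊛ Q) k} {((H PS.⊛ proj₁ H-inverse) PS.⊛ F) k} {F k}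
        (S.sym {((H PS.⊛ proj₁ H-inverse) PS.⊛ F) k} {(H PS.⊛ Q) k} (PS.⊛-assoc H (proj₁ H-inverse) F k))
        (S.trans {((H PS.⊛ proj₁ H-inverse) PS.⊛ F) k} {(PS.1ₛ PS.⊛ F) k} {F k}
          (PS.⊛-cong {H PS.⊛ proj₁ H-inverse} {PS.1ₛ} {F} {F} (proj₂ H-inverse) (λ _ _ → refl) k)
          (PS.⊛-identityˡ F k))

    CTₓ-formula : ∀ 1/G → (embed G LL.* 1/G) LL.≈ LL.1# → ∀ 1/∂xG → ((∂x G at X) S.* 1/∂xG) S.≈ S.1# →
      CTₓ ((x LL.* 1/G) LL.* embed F) K⟨⟨t⟩⟩.≈ fromSeries ((F at X) S.* 1/∂xG)
    CTₓ-formula 1/G G/G≈1 1/∂xG ∂xG/∂xG≈1 = LaurentProperties.≋⇒≈ₗ R {CTₓ E} {fromSeries ((F at X) S.* 1/∂xG)} λ n →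
      -- `CTₓ E` keeps the pole of E and the right side has pole 0, so cross multiplication leaves
      -- t^(pole E) on the right.
      trans (≡.subst (λ p → slice 0 E n ≈ shift^ p (Q at X) n) (ℕ.+-identityʳ (pole E)) (slice-0 X E Q E[x-X]≈xQ n))
            (shift^-cong (pole E) Q-at-X n)
      where
      E : LL.Carrier
      E = (x LL.* 1/G) LL.* embed F

      E[x-X]≈xQ : E LL.* embed (x-X X) LL.≈ x LL.* embed Q
      E[x-X]≈xQ = Rearrangements.cancel-inverse LL x 1/G (embed (x-X X)) (embed G) (embed H) (embed F) (embed Q) G/G≈1
        (LL.trans {embed (x-X X) LL.* embed H} {embed (x-X X PS.⊛ H)} {embed G}
          (embed-⊛ (x-X X) H) (embed-cong {x-X X PS.⊛ H} {G} (factor X G root)))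
        (LL.trans {embed H LL.* embed Q} {embed (H PS.⊛ Q)} {embed F}
          (embed-⊛ H Q) (embed-cong {H PS.⊛ Q} {F} HQ≋F))

      Q-at-X : Q at X ≋ (F at X) ⊛ 1/∂xG
      Q-at-X = Rearrangements.divide S (Q at X) (H at X) (F at X) (∂x G at X) 1/∂xG
        (λ n → trans (sym (ev-⊛ X H Q n)) (at-cong {H PS.⊛ Q} {F} X HQ≋F n))
        (λ n → trans (at-cong {∂x G} {derivative X G} X (∂x-derivative X G) n) (ev-derivative X G n))
        ∂xG/∂xG≈1

mainTheorem2 : ∀ {c ℓ₁ ℓ₂ : Level} (K : HeytingField c ℓ₁ ℓ₂) →
    let open Series K in
    CharacteristicZero K →
    (G F : K⟦x,t⟧) (a : Carrier) →
    G 0 0 ≈ 0# → G 1 0 ≈ a → a # 0# →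
    Invertible K⟨⟨x⟩⟩⟨⟨t⟩⟩ (embed G) ×
    ∃! _≈ᵗ_ (λ X → (G at X) K⟦t⟧.≈ K⟦t⟧.0#) ×
    (∀ (X : tK⟦t⟧) → (G at X) K⟦t⟧.≈ K⟦t⟧.0# →
    Invertible K⟦t⟧ (∂x G at X) ×
    (∀ (1/G : Invertible K⟨⟨x⟩⟩⟨⟨t⟩⟩ (embed G))
    (1/∂xG : Invertible K⟦t⟧ (∂x G at X)) →
    CTₓ ((x K⟨⟨x⟩⟩⟨⟨t⟩⟩.* proj₁ 1/G) K⟨⟨x⟩⟩⟨⟨t⟩⟩.* embed F)
    K⟨⟨t⟩⟩.≈
    fromSeries ((F at X) K⟦t⟧.* proj₁ 1/∂xG)))
mainTheorem2 K _ G F a G₀₀≈0 G₁₀≈a a#0 =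
  Embedding.embed-invertible K G G₀₀≈0 u G₁₀u≈1 ,
  AtProperties.Root.root-∃! K G G₀₀≈0 (proj₁ V) (proj₂ V) ,
  λ X root →
    Residue.∂x-at-invertible K G u G₁₀u≈1 X ,
    λ (1/G , _ , G/G≈1) (1/∂xG , _ , ∂xG/∂xG≈1) →
      Residue.CTₓ-formula K G F u G₁₀u≈1 X root 1/G G/G≈1 1/∂xG ∂xG/∂xG≈1
  where
  open CommutativeRing (AtProperties.R K)
  u : Carrier
  u = proj₁ (HeytingField.#⇒invertible K a#0)

  -- Apartness from zero yields an inverse of the difference `a - 0#`, not of a literally.
  G₁₀≈a-0 : G 1 0 ≈ a - 0#
  G₁₀≈a-0 = trans G₁₀≈a (sym (trans (+-congˡ (RingProperties.-0#≈0# ring)) (+-identityʳ a)))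

  G₁₀u≈1 : G 1 0 * u ≈ 1#
  G₁₀u≈1 = trans (*-congʳ G₁₀≈a-0) (proj₂ (proj₂ (HeytingField.#⇒invertible K a#0)))

  V : ∃ λ V → PowerSeriesProperties._≋_ (AtProperties.R K)
                (PowerSeriesProperties._⊛_ (AtProperties.R K) (G 1) V) (PowerSeriesProperties.1ₛ (AtProperties.R K))
  V = PowerSeriesProperties.inverse (AtProperties.R K) (G 1) u G₁₀u≈1
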